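{- Let $m$ be a positive integer and $I=\{m\}$. If $z_0\in\mathbb C$ satisfies $d(I;z_0)=0$, then $|z_0|\le m$ and $\mathrm{Re}(z_0)\ge -1$.
   Context: For a finite set $I$ of positive integers, $d(I;z)$ denotes the descent polynomial: the unique polynomial whose value at each integer $n>\max(I\cup\{0\})$ is the number of permutations $\pi\in\mathfrak S_n$ with $\{j\mid\pi_j>\pi_{j+1}\}=I$, evaluated at a complex number $z$. (For $I=\{m\}$ one has $d(I;z)=\binom{z}{m}-1$, with $\binom{z}{m}=z(z-1)\cdots(z-m+1)/m!$.) -}

module Defs where

open import Data.Fin.Base as Fin using (Fin; toℕ)
open import Data.Fin.Permutation as Perm using (Permutation′; _⟨$⟩ʳ_)
open import Data.Integer.Base as ℤ using (+_; +[1+_]; -[1+_])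
import Data.Integer.Properties as ℤ
open import Data.Integer.Solver using () renaming (module +-*-Solver to ℤ-Solver)
open import Data.List.Base using (List; foldr)
open import Data.List.Extrema.Nat using (max)
open import Data.List.Membership.Propositional using (_∈_)
open import Data.Nat.Base as ℕ using (ℕ; zero; suc)
import Data.Nat.Properties as ℕ
open import Data.Product.Base using (Σ; ∃-syntax; _×_; _,_; proj₁; proj₂)
open import Data.Rational.Base
import Data.Rational.Properties as ℚ
open import Data.Rational.Solver using (module +-*-Solver)
import Data.Rational.Unnormalised.Base as ℚᵘ
import Data.Rational.Unnormalised.Properties as ℚᵘ
open import Data.Sum.Base using (_⊎_; inj₁; inj₂)
open import Function.Bundles using (_⇔_; Bijection)
open import Level using (0ℓ)
open import Relation.Binary.Bundles using (Setoid)
open import Relation.Binary.PropositionalEquality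
open import Relation.Nullary using (yes; no; contradiction)

0<1 : 0ℚ < 1ℚ
0<1 = *<* (ℤ.+<+ (ℕ.s≤s ℕ.z≤n))

½-pos : ∀ {ε} → 0ℚ < ε → 0ℚ < ½ * ε
½-pos {ε} 0<ε = subst (_< ½ * ε) (ℚ.*-zeroʳ ½) (ℚ.*-monoʳ-<-pos ½ 0<ε)

*-pos : ∀ {p q} → 0ℚ < p → 0ℚ < q → 0ℚ < p * q
*-pos {p} {q} 0<p 0<q =
  subst (_< p * q) (ℚ.*-zeroʳ p) (ℚ.*-monoʳ-<-pos p {{positive 0<p}} 0<q)

halves : ∀ ε → ½ * ε + ½ * ε ≡ ε
halves ε = trans (sym (ℚ.*-distribʳ-+ ε ½ ½)) (ℚ.*-identityˡ ε)

p≤∣p∣ : ∀ p → p ≤ ∣ p ∣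
p≤∣p∣ p with ℚ.≤-total 0ℚ p
... | inj₁ 0≤p = ℚ.≤-reflexive (sym (ℚ.0≤p⇒∣p∣≡p 0≤p))
... | inj₂ p≤0 = ℚ.≤-trans p≤0 (ℚ.0≤∣p∣ p)

∣p-q∣≡∣q-p∣ : ∀ p q → ∣ p - q ∣ ≡ ∣ q - p ∣
∣p-q∣≡∣q-p∣ p q = trans (sym (ℚ.∣-p∣≡∣p∣ (p - q)))
  (cong ∣_∣ (solve 2 (λ p q → :- (p :- q) := q :- p) refl p q))
  where
  open +-*-Solver

∣p-q∣≤r⇒p≤q+r : ∀ {p q r} → ∣ p - q ∣ ≤ r → p ≤ q + r
∣p-q∣≤r⇒p≤q+r {p} {q} {r} h =
  subst (_≤ q + r) (solve 2 (λ p q → q :+ (p :- q) := p) refl p q)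
    (ℚ.+-monoʳ-≤ q (ℚ.≤-trans (p≤∣p∣ (p - q)) h))
  where
  open +-*-Solver

p≤q+r⇒p-q≤r : ∀ {p q r} → p ≤ q + r → p - q ≤ r
p≤q+r⇒p-q≤r {p} {q} {r} h =
  subst (p - q ≤_) (solve 2 (λ q r → q :+ r :- q := r) refl q r)
    (ℚ.+-monoˡ-≤ (- q) h)
  where
  open +-*-Solver

∣p-q∣≤r : ∀ {p q r} → p ≤ q + r → q ≤ p + r → ∣ p - q ∣ ≤ r
∣p-q∣≤r {p} {q} {r} h₁ h₂ with ℚ.∣p∣≡p∨∣p∣≡-p (p - q)
... | inj₁ eq = subst (_≤ r) (sym eq) (p≤q+r⇒p-q≤r h₁)
... | inj₂ eq = subst (_≤ r)
  (sym (trans eq (solve 2 (λ p q → :- (p :- q) := q :- p) refl p q)))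
  (p≤q+r⇒p-q≤r h₂)
  where
  open +-*-Solver

*-mono-≤-nonNeg : ∀ {p q r s} → 0ℚ ≤ r → 0ℚ ≤ q → p ≤ q → r ≤ s → p * r ≤ q * s
*-mono-≤-nonNeg {p} {q} {r} {s} 0≤r 0≤q p≤q r≤s = ℚ.≤-trans
  (ℚ.*-monoʳ-≤-nonNeg r {{nonNegative 0≤r}} p≤q)
  (ℚ.*-monoˡ-≤-nonNeg q {{nonNegative 0≤q}} r≤s)

square-cancel-≤ : ∀ {p q} → 0ℚ ≤ p → 0ℚ ≤ q → p * p ≤ q * q → p ≤ q
square-cancel-≤ {p} {q} 0≤p 0≤q h with p ℚ.≤? q
... | yes p≤q = p≤q
... | no  p≰q = contradiction
  (ℚ.<-≤-trans
    (ℚ.≤-<-trans (ℚ.*-monoˡ-≤-nonNeg q {{nonNegative 0≤q}} (ℚ.<⇒≤ q<p))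
                 (ℚ.*-monoˡ-<-pos p {{positive (ℚ.≤-<-trans 0≤q q<p)}} q<p))
    h)
  (ℚ.<-irrefl refl)
  where q<p = ℚ.≰⇒> p≰q

fromℕ : ℕ → ℚ
fromℕ n = + n / 1

0≤fromℕ : ∀ n → 0ℚ ≤ fromℕ n
0≤fromℕ n = ℚ.nonNegative⁻¹ (fromℕ n) {{ℚ.normalize-nonNeg n 1}}


fromℕ-suc : ∀ n → fromℕ (suc n) ≡ fromℕ n + 1ℚ
fromℕ-suc n = ℚ.toℚᵘ-injective (begin
  toℚᵘ (fromℕ (suc n))          ≈⟨ ℚ.toℚᵘ-fromℚᵘ (ℚᵘ.mkℚᵘ (+ suc n) 0) ⟩
  ℚᵘ.mkℚᵘ (+ suc n) 0           ≈⟨ ℚᵘ.*≡* (lemma (+ n)) ⟩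
  ℚᵘ.mkℚᵘ (+ n) 0 ℚᵘ.+ ℚᵘ.1ℚᵘ   ≈⟨ ℚᵘ.+-congˡ ℚᵘ.1ℚᵘ (ℚ.toℚᵘ-fromℚᵘ (ℚᵘ.mkℚᵘ (+ n) 0)) ⟨
  toℚᵘ (fromℕ n) ℚᵘ.+ ℚᵘ.1ℚᵘ    ≈⟨ ℚ.toℚᵘ-homo-+ (fromℕ n) 1ℚ ⟨
  toℚᵘ (fromℕ n + 1ℚ)           ∎)
  where
  open ℚᵘ.≃-Reasoning
  lemma : ∀ i → (+ 1 ℤ.+ i) ℤ.* + 1 ≡ (i ℤ.* + 1 ℤ.+ + 1 ℤ.* + 1) ℤ.* + 1
  lemma = solve 1 (λ i → (con (+ 1) :+ i) :* con (+ 1)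
                      := (i :* con (+ 1) :+ con (+ 1) :* con (+ 1)) :* con (+ 1)) refl
    where
    open ℤ-Solver

fromℕ-+ : ∀ m n → fromℕ (m ℕ.+ n) ≡ fromℕ m + fromℕ n
fromℕ-+ zero    n = sym (ℚ.+-identityˡ (fromℕ n))
fromℕ-+ (suc m) n = begin
  fromℕ (suc (m ℕ.+ n))       ≡⟨ fromℕ-suc (m ℕ.+ n) ⟩
  fromℕ (m ℕ.+ n) + 1ℚ        ≡⟨ cong (_+ 1ℚ) (fromℕ-+ m n) ⟩
  fromℕ m + fromℕ n + 1ℚ      ≡⟨ solve 3 (λ a b c → a :+ b :+ c := a :+ c :+ b) refl (fromℕ m) (fromℕ n) 1ℚ ⟩
  fromℕ m + 1ℚ + fromℕ n      ≡⟨ cong (_+ fromℕ n) (fromℕ-suc m) ⟨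
  fromℕ (suc m) + fromℕ n     ∎
  where
  open ≡-Reasoning
  open +-*-Solver

fromℕ-* : ∀ m n → fromℕ (m ℕ.* n) ≡ fromℕ m * fromℕ n
fromℕ-* zero    n = sym (ℚ.*-zeroˡ (fromℕ n))
fromℕ-* (suc m) n = begin
  fromℕ (n ℕ.+ m ℕ.* n)           ≡⟨ fromℕ-+ n (m ℕ.* n) ⟩
  fromℕ n + fromℕ (m ℕ.* n)       ≡⟨ cong (_+_ (fromℕ n)) (fromℕ-* m n) ⟩
  fromℕ n + fromℕ m * fromℕ n     ≡⟨ solve 2 (λ a b → b :+ a :* b := (a :+ con 1ℚ) :* b) refl (fromℕ m) (fromℕ n) ⟩
  (fromℕ m + 1ℚ) * fromℕ n        ≡⟨ cong (_* fromℕ n) (fromℕ-suc m) ⟨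
  fromℕ (suc m) * fromℕ n         ∎
  where
  open ≡-Reasoning
  open +-*-Solver

p<fromℕ[1+∣↥p∣] : ∀ p → p < fromℕ (suc ℤ.∣ ↥ p ∣)
p<fromℕ[1+∣↥p∣] p@(mkℚ i d _) = ℚ.toℚᵘ-cancel-<
  (ℚᵘ.<-respʳ-≃ (ℚᵘ.≃-sym (ℚ.toℚᵘ-fromℚᵘ (ℚᵘ.mkℚᵘ (+ suc ℤ.∣ i ∣) 0))) (ℚᵘ.*<* (lemma i)))
  where
  lemma : ∀ i → i ℤ.* + 1 ℤ.< + suc ℤ.∣ i ∣ ℤ.* + suc d
  lemma (+ n)    = subst₂ ℤ._<_ (sym (ℤ.*-identityʳ (+ n))) (ℤ.pos-* (suc n) (suc d))
    (ℤ.+<+ (ℕ.m≤m*n (suc n) (suc d)))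
  lemma -[1+ n ] = subst (ℤ._< + suc (suc n) ℤ.* + suc d) (sym (ℤ.*-identityʳ -[1+ n ])) ℤ.-<+

1/suc : ℕ → ℚ
1/suc n = + 1 / suc n

0<1/suc : ∀ n → 0ℚ < 1/suc n
0<1/suc n = ℚ.positive⁻¹ (1/suc n) {{ℚ.normalize-pos 1 (suc n)}}

fromℕ-*-1/suc : ∀ n → fromℕ (suc n) * 1/suc n ≡ 1ℚ
fromℕ-*-1/suc n = ℚ.toℚᵘ-injective (begin
  toℚᵘ (fromℕ (suc n) * 1/suc n)                 ≈⟨ ℚ.toℚᵘ-homo-* (fromℕ (suc n)) (1/suc n) ⟩
  toℚᵘ (fromℕ (suc n)) ℚᵘ.* toℚᵘ (1/suc n)       ≈⟨ ℚᵘ.*-cong (ℚ.toℚᵘ-fromℚᵘ (ℚᵘ.mkℚᵘ (+ suc n) 0))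
                                                             (ℚ.toℚᵘ-fromℚᵘ (ℚᵘ.mkℚᵘ (+ 1) n)) ⟩
  ℚᵘ.mkℚᵘ (+ suc n) 0 ℚᵘ.* ℚᵘ.mkℚᵘ (+ 1) n       ≈⟨ ℚᵘ.*≡* (cong (λ k → + suc k) (lemma n)) ⟩
  ℚᵘ.1ℚᵘ                                         ∎)
  where
  open ℚᵘ.≃-Reasoning
  lemma : ∀ n → (n ℕ.* 1) ℕ.* 1 ≡ n ℕ.+ 0 ℕ.+ 0
  lemma n = trans (ℕ.*-identityʳ (n ℕ.* 1)) (trans (ℕ.*-identityʳ n)
    (sym (trans (ℕ.+-identityʳ (n ℕ.+ 0)) (ℕ.+-identityʳ n))))

1/suc-≤ : ∀ {ε} → 0ℚ < ε → ∀ {n} → ↧ₙ ε ℕ.≤ suc n → 1/suc n ≤ ε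
1/suc-≤ {mkℚ i d _} 0<ε {n} d≤n = ℚ.toℚᵘ-cancel-≤
  (ℚᵘ.≤-respˡ-≃ (ℚᵘ.≃-sym (ℚ.toℚᵘ-fromℚᵘ (ℚᵘ.mkℚᵘ (+ 1) n))) (ℚᵘ.*≤* (lemma i (positive 0<ε))))
  where
  lemma : ∀ i → ℤ.Positive i → + 1 ℤ.* + suc d ℤ.≤ i ℤ.* + suc n
  lemma +[1+ k ] _ = subst₂ ℤ._≤_ (ℤ.pos-* 1 (suc d)) (ℤ.pos-* (suc k) (suc n))
    (ℤ.+≤+ (ℕ.*-mono-≤ {1} {suc k} (ℕ.s≤s ℕ.z≤n) d≤n))

IsCauchy : (ℕ → ℚ) → Set
IsCauchy x = ∀ ε → 0ℚ < ε →
  ∃[ N ] (∀ m n → N ℕ.≤ m → N ℕ.≤ n → ∣ x m - x n ∣ ≤ ε)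

-- A Cauchy sequence of rationals; equality of reals is _≈ℝ_ below, not _≡_.
record ℝ : Set where
  constructor mkℝ
  field
    seq    : ℕ → ℚ
    cauchy : IsCauchy seq

open ℝ public

infix 4 _≈ℝ_ _≤ℝ_

_≈ℝ_ : ℝ → ℝ → Set
x ≈ℝ y = ∀ ε → 0ℚ < ε → ∃[ N ] (∀ n → N ℕ.≤ n → ∣ seq x n - seq y n ∣ ≤ ε)

_≤ℝ_ : ℝ → ℝ → Set
x ≤ℝ y = ∀ ε → 0ℚ < ε → ∃[ N ] (∀ n → N ℕ.≤ n → seq x n ≤ seq y n + ε)

fromℚ : ℚ → ℝ
fromℚ q = mkℝ (λ _ → q) λ ε 0<ε → 0 , λ _ _ _ _ →
  subst (_≤ ε) (sym (cong ∣_∣ (ℚ.+-inverseʳ q))) (ℚ.<⇒≤ 0<ε)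

0ℝ 1ℝ : ℝ
0ℝ = fromℚ 0ℚ
1ℝ = fromℚ 1ℚ

infix  8 -ℝ_
infixl 7 _*ℝ_
infixl 6 _+ℝ_ _-ℝ_

_+ℝ_ : ℝ → ℝ → ℝ
mkℝ x cx +ℝ mkℝ y cy = mkℝ (λ n → x n + y n) λ ε 0<ε →
  let M , hM = cx (½ * ε) (½-pos 0<ε)
      N , hN = cy (½ * ε) (½-pos 0<ε)
  in M ℕ.⊔ N , λ m n ≤m ≤n → begin
    ∣ x m + y m - (x n + y n) ∣        ≡⟨ cong ∣_∣ (solve 4
      (λ a b c d → a :+ b :- (c :+ d) := (a :- c) :+ (b :- d)) refl (x m) (y m) (x n) (y n)) ⟩
    ∣ (x m - x n) + (y m - y n) ∣      ≤⟨ ℚ.∣p+q∣≤∣p∣+∣q∣ (x m - x n) (y m - y n) ⟩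
    ∣ x m - x n ∣ + ∣ y m - y n ∣      ≤⟨ ℚ.+-mono-≤
      (hM m n (ℕ.m⊔n≤o⇒m≤o M N ≤m) (ℕ.m⊔n≤o⇒m≤o M N ≤n))
      (hN m n (ℕ.m⊔n≤o⇒n≤o M N ≤m) (ℕ.m⊔n≤o⇒n≤o M N ≤n)) ⟩
    ½ * ε + ½ * ε                      ≡⟨ halves ε ⟩
    ε                                  ∎
  where
  open ℚ.≤-Reasoning
  open +-*-Solver

-ℝ_ : ℝ → ℝ
-ℝ mkℝ x cx = mkℝ (λ n → - x n) λ ε 0<ε →
  let N , hN = cx ε 0<ε
  in N , λ m n ≤m ≤n → subst (_≤ ε)
    (trans (∣p-q∣≡∣q-p∣ (x m) (x n)) (cong ∣_∣
      (solve 2 (λ a b → b :- a := :- a :- (:- b)) refl (x m) (x n))))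
    (hN m n ≤m ≤n)
  where
  open +-*-Solver

_-ℝ_ : ℝ → ℝ → ℝ
x -ℝ y = x +ℝ (-ℝ y)

eventuallyBounded : ∀ {x} → IsCauchy x →
  ∃[ B ] 0ℚ < B × ∃[ N ] (∀ n → N ℕ.≤ n → ∣ x n ∣ ≤ B)
eventuallyBounded {x} cx =
  let N , hN = cx 1ℚ 0<1
  in ∣ x N ∣ + 1ℚ
   , ℚ.+-mono-≤-< {0ℚ} {∣ x N ∣} {0ℚ} {1ℚ} (ℚ.0≤∣p∣ (x N)) 0<1
   , N , λ n ≤n → begin
     ∣ x n ∣                     ≡⟨ cong ∣_∣ (solve 2
       (λ a b → a := b :+ (a :- b)) refl (x n) (x N)) ⟩
     ∣ x N + (x n - x N) ∣       ≤⟨ ℚ.∣p+q∣≤∣p∣+∣q∣ (x N) (x n - x N) ⟩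
     ∣ x N ∣ + ∣ x n - x N ∣     ≤⟨ ℚ.+-monoʳ-≤ ∣ x N ∣ (hN n N ≤n ℕ.≤-refl) ⟩
     ∣ x N ∣ + 1ℚ                ∎
  where
  open ℚ.≤-Reasoning
  open +-*-Solver

_*ℝ_ : ℝ → ℝ → ℝ
mkℝ x cx *ℝ mkℝ y cy = mkℝ (λ n → x n * y n) λ ε 0<ε → helper ε 0<ε
  (eventuallyBounded cx) (eventuallyBounded cy)
  where
  open ℚ.≤-Reasoning
  open +-*-Solver
  helper : ∀ ε → 0ℚ < ε →
    ∃[ B ] 0ℚ < B × ∃[ N ] (∀ n → N ℕ.≤ n → ∣ x n ∣ ≤ B) →
    ∃[ B ] 0ℚ < B × ∃[ N ] (∀ n → N ℕ.≤ n → ∣ y n ∣ ≤ B) →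
    ∃[ N ] (∀ m n → N ℕ.≤ m → N ℕ.≤ n → ∣ x m * y m - x n * y n ∣ ≤ ε)
  helper ε 0<ε (B , 0<B , K , hK) (C , 0<C , L , hL) = K ℕ.⊔ L ℕ.⊔ (M ℕ.⊔ N) , λ m n ≤m ≤n →
    let K≤m = ℕ.m⊔n≤o⇒m≤o K L (ℕ.m⊔n≤o⇒m≤o (K ℕ.⊔ L) (M ℕ.⊔ N) ≤m)
        L≤n = ℕ.m⊔n≤o⇒n≤o K L (ℕ.m⊔n≤o⇒m≤o (K ℕ.⊔ L) (M ℕ.⊔ N) ≤n)
        ≤m′ = ℕ.m⊔n≤o⇒n≤o (K ℕ.⊔ L) (M ℕ.⊔ N) ≤m
        ≤n′ = ℕ.m⊔n≤o⇒n≤o (K ℕ.⊔ L) (M ℕ.⊔ N) ≤n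
    in begin
    ∣ x m * y m - x n * y n ∣                          ≡⟨ cong ∣_∣ (solve 4
      (λ a b c d → a :* b :- c :* d := a :* (b :- d) :+ (a :- c) :* d) refl (x m) (y m) (x n) (y n)) ⟩
    ∣ x m * (y m - y n) + (x m - x n) * y n ∣          ≤⟨ ℚ.∣p+q∣≤∣p∣+∣q∣ (x m * (y m - y n)) ((x m - x n) * y n) ⟩
    ∣ x m * (y m - y n) ∣ + ∣ (x m - x n) * y n ∣      ≡⟨ cong₂ _+_
      (ℚ.∣p*q∣≡∣p∣*∣q∣ (x m) (y m - y n)) (ℚ.∣p*q∣≡∣p∣*∣q∣ (x m - x n) (y n)) ⟩
    ∣ x m ∣ * ∣ y m - y n ∣ + ∣ x m - x n ∣ * ∣ y n ∣  ≤⟨ ℚ.+-mono-≤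
      (*-mono-≤-nonNeg (ℚ.0≤∣p∣ (y m - y n)) (ℚ.<⇒≤ 0<B) (hK m K≤m)
        (hN m n (ℕ.m⊔n≤o⇒n≤o M N ≤m′) (ℕ.m⊔n≤o⇒n≤o M N ≤n′)))
      (*-mono-≤-nonNeg (ℚ.0≤∣p∣ (y n)) (ℚ.<⇒≤ 0<δ)
        (hM m n (ℕ.m⊔n≤o⇒m≤o M N ≤m′) (ℕ.m⊔n≤o⇒m≤o M N ≤n′)) (hL n L≤n)) ⟩
    B * δ + δ * C                                      ≡⟨ solve 4
      (λ b c e i → b :* (e :* i) :+ (e :* i) :* c := e :* ((b :+ c) :* i)) refl B C ε (1/ (B + C)) ⟩
    ε * ((B + C) * 1/ (B + C))                         ≡⟨ cong (ε *_) (ℚ.*-inverseʳ (B + C)) ⟩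
    ε * 1ℚ                                             ≡⟨ ℚ.*-identityʳ ε ⟩
    ε                                                  ∎
    where
    instance
      B+C-pos : Positive (B + C)
      B+C-pos = positive (ℚ.+-mono-< 0<B 0<C)
      B+C-nonZero : NonZero (B + C)
      B+C-nonZero = ℚ.pos⇒nonZero (B + C)
    δ = ε * 1/ (B + C)
    0<δ = *-pos 0<ε (ℚ.positive⁻¹ (1/ (B + C)) {{ℚ.1/pos⇒pos (B + C)}})
    M = proj₁ (cx δ 0<δ)
    hM = proj₂ (cx δ 0<δ)
    N = proj₁ (cy δ 0<δ)
    hN = proj₂ (cy δ 0<δ)

-- The largest multiple kδ with k ≤ K whose square is at most q (0 if there is none).
gridRoot : (δ q : ℚ) (K : ℕ) → ℚ
gridRoot δ q zero    = 0ℚ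
gridRoot δ q (suc k) with (fromℕ (suc k) * δ) * (fromℕ (suc k) * δ) ℚ.≤? q
... | yes _ = fromℕ (suc k) * δ
... | no  _ = gridRoot δ q k

gridRoot-lower : ∀ δ q K → gridRoot δ q K ≡ 0ℚ ⊎ gridRoot δ q K * gridRoot δ q K ≤ q
gridRoot-lower δ q zero    = inj₁ refl
gridRoot-lower δ q (suc k) with (fromℕ (suc k) * δ) * (fromℕ (suc k) * δ) ℚ.≤? q
... | yes h = inj₂ h
... | no  _ = gridRoot-lower δ q k

0≤gridRoot : ∀ {δ} → 0ℚ < δ → ∀ q K → 0ℚ ≤ gridRoot δ q K
0≤gridRoot 0<δ q zero    = ℚ.≤-refl
0≤gridRoot {δ} 0<δ q (suc k) with (fromℕ (suc k) * δ) * (fromℕ (suc k) * δ) ℚ.≤? q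
... | yes h = subst (_≤ fromℕ (suc k) * δ) (ℚ.*-zeroˡ δ)
  (ℚ.*-monoʳ-≤-nonNeg δ {{ℚ.pos⇒nonNeg δ {{positive 0<δ}}}} (0≤fromℕ (suc k)))
... | no  _ = 0≤gridRoot 0<δ q k

gridRoot-upper : ∀ δ q K → q < (fromℕ (suc K) * δ) * (fromℕ (suc K) * δ) →
  q < (gridRoot δ q K + δ) * (gridRoot δ q K + δ)
gridRoot-upper δ q zero    h = subst (λ p → q < p * p)
  (trans (ℚ.*-identityˡ δ) (sym (ℚ.+-identityˡ δ))) h
gridRoot-upper δ q (suc k) h with (fromℕ (suc k) * δ) * (fromℕ (suc k) * δ) ℚ.≤? q
... | yes _ = subst (λ p → q < p * p)
  (trans (cong (_* δ) (fromℕ-suc (suc k)))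
    (solve 2 (λ a d → (a :+ con 1ℚ) :* d := a :* d :+ d) refl (fromℕ (suc k)) δ)) h
  where
  open +-*-Solver
... | no  ≰q = gridRoot-upper δ q k (ℚ.≰⇒> ≰q)

-- √q rounded down to a multiple of 1/(n+1).
√≈ : ℕ → ℚ → ℚ
√≈ n q = gridRoot (1/suc n) q (suc ℤ.∣ ↥ q ∣ ℕ.* suc n)

√≈-lower : ∀ n q → √≈ n q ≡ 0ℚ ⊎ √≈ n q * √≈ n q ≤ q
√≈-lower n q = gridRoot-lower (1/suc n) q (suc ℤ.∣ ↥ q ∣ ℕ.* suc n)

0≤√≈ : ∀ n q → 0ℚ ≤ √≈ n q
0≤√≈ n q = 0≤gridRoot (0<1/suc n) q (suc ℤ.∣ ↥ q ∣ ℕ.* suc n)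

√≈-upper : ∀ n q → q < (√≈ n q + 1/suc n) * (√≈ n q + 1/suc n)
√≈-upper n q = gridRoot-upper δ q K (begin-strict
  q                                          <⟨ p<fromℕ[1+∣↥p∣] q ⟩
  b                                          ≡⟨ ℚ.*-identityʳ b ⟨
  b * 1ℚ                                     ≤⟨ *-mono-≤-nonNeg (ℚ.<⇒≤ 0<1) 0≤t b≤t 1≤t ⟩
  t * t                                      ∎)
  where
  open ℚ.≤-Reasoning
  open +-*-Solver
  δ = 1/suc n
  B = suc ℤ.∣ ↥ q ∣
  K = B ℕ.* suc n
  b = fromℕ B
  t = fromℕ (suc K) * δ
  t≡b+δ : t ≡ b + δ
  t≡b+δ = begin-equality
    fromℕ (suc K) * δ                  ≡⟨ cong (_* δ) (trans (fromℕ-suc K) (cong (_+ 1ℚ) (fromℕ-* B (suc n)))) ⟩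
    (b * fromℕ (suc n) + 1ℚ) * δ       ≡⟨ solve 3 (λ b s d → (b :* s :+ con 1ℚ) :* d := b :* (s :* d) :+ d) refl b (fromℕ (suc n)) δ ⟩
    b * (fromℕ (suc n) * δ) + δ        ≡⟨ cong (λ p → b * p + δ) (fromℕ-*-1/suc n) ⟩
    b * 1ℚ + δ                         ≡⟨ cong (_+ δ) (ℚ.*-identityʳ b) ⟩
    b + δ                              ∎
  b≤t : b ≤ t
  b≤t = begin
    b         ≡⟨ ℚ.+-identityʳ b ⟨
    b + 0ℚ    ≤⟨ ℚ.+-monoʳ-≤ b (ℚ.<⇒≤ (0<1/suc n)) ⟩
    b + δ     ≡⟨ t≡b+δ ⟨
    t         ∎
  0≤t : 0ℚ ≤ t
  0≤t = ℚ.≤-trans (0≤fromℕ B) b≤t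
  1≤t : 1ℚ ≤ t
  1≤t = begin
    1ℚ                        ≡⟨ ℚ.+-identityˡ 1ℚ ⟨
    0ℚ + 1ℚ                   ≤⟨ ℚ.+-monoˡ-≤ 1ℚ (0≤fromℕ ℤ.∣ ↥ q ∣) ⟩
    fromℕ ℤ.∣ ↥ q ∣ + 1ℚ      ≡⟨ fromℕ-suc ℤ.∣ ↥ q ∣ ⟨
    b                         ≤⟨ b≤t ⟩
    t                         ∎

√≈-step : ∀ {η} → 0ℚ < η → ∀ m n p q → 1/suc n ≤ η → p ≤ q + η * η →
  √≈ m p ≤ √≈ n q + (η + η)
√≈-step {η} 0<η m n p q δ≤η p≤q+η² = helper (√≈-lower m p)
  where
  open ℚ.≤-Reasoning
  open +-*-Solver
  s = √≈ n q
  δ = 1/suc n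
  0≤η = ℚ.<⇒≤ 0<η
  0≤s+η : 0ℚ ≤ s + η
  0≤s+η = ℚ.+-mono-≤ {0ℚ} {s} {0ℚ} {η} (0≤√≈ n q) 0≤η
  0≤s+δ : 0ℚ ≤ s + δ
  0≤s+δ = ℚ.+-mono-≤ {0ℚ} {s} {0ℚ} {δ} (0≤√≈ n q) (ℚ.<⇒≤ (0<1/suc n))
  0≤s+2η : 0ℚ ≤ s + (η + η)
  0≤s+2η = ℚ.+-mono-≤ {0ℚ} {s} {0ℚ} {η + η} (0≤√≈ n q) (ℚ.+-mono-≤ {0ℚ} {η} {0ℚ} {η} 0≤η 0≤η)
  0≤cross : 0ℚ ≤ (s + η) * η + (s + η) * η
  0≤cross = ℚ.+-mono-≤ {0ℚ} {(s + η) * η} {0ℚ} {(s + η) * η} h h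
    where h = subst (_≤ (s + η) * η) (ℚ.*-zeroˡ η)
                (ℚ.*-monoʳ-≤-nonNeg η {{nonNegative 0≤η}} 0≤s+η)
  helper : √≈ m p ≡ 0ℚ ⊎ √≈ m p * √≈ m p ≤ p → √≈ m p ≤ s + (η + η)
  helper (inj₁ eq) = subst (_≤ s + (η + η)) (sym eq) 0≤s+2η
  helper (inj₂ h)  = square-cancel-≤ (0≤√≈ m p) 0≤s+2η (begin
    √≈ m p * √≈ m p                                        ≤⟨ h ⟩
    p                                                      ≤⟨ p≤q+η² ⟩
    q + η * η                                              ≤⟨ ℚ.+-monoˡ-≤ (η * η) (ℚ.<⇒≤ (√≈-upper n q)) ⟩
    (s + δ) * (s + δ) + η * η                              ≤⟨ ℚ.+-monoˡ-≤ (η * η)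
      (*-mono-≤-nonNeg 0≤s+δ 0≤s+η (ℚ.+-monoʳ-≤ s δ≤η) (ℚ.+-monoʳ-≤ s δ≤η)) ⟩
    (s + η) * (s + η) + η * η                              ≡⟨ ℚ.+-identityʳ _ ⟨
    (s + η) * (s + η) + η * η + 0ℚ                         ≤⟨ ℚ.+-monoʳ-≤ ((s + η) * (s + η) + η * η) 0≤cross ⟩
    (s + η) * (s + η) + η * η + ((s + η) * η + (s + η) * η) ≡⟨ solve 2
      (λ s e → (s :+ e) :* (s :+ e) :+ e :* e :+ ((s :+ e) :* e :+ (s :+ e) :* e)
            := (s :+ (e :+ e)) :* (s :+ (e :+ e))) refl s η ⟩
    (s + (η + η)) * (s + (η + η))                          ∎)

-- Gives 0 on negative reals.
√ : ℝ → ℝ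
√ (mkℝ x cx) = mkℝ (λ n → √≈ n (x n)) λ ε 0<ε →
  let η = ½ * ε
      0<η = ½-pos 0<ε
      N , hN = cx (η * η) (*-pos 0<η 0<η)
      small : ∀ n → N ℕ.⊔ ↧ₙ η ℕ.≤ n → 1/suc n ≤ η
      small n ≤n = 1/suc-≤ 0<η (ℕ.m≤n⇒m≤1+n (ℕ.m⊔n≤o⇒n≤o N (↧ₙ η) ≤n))
      step : ∀ m n → N ℕ.⊔ ↧ₙ η ℕ.≤ m → N ℕ.⊔ ↧ₙ η ℕ.≤ n →
             √≈ m (x m) ≤ √≈ n (x n) + ε
      step m n ≤m ≤n = subst (λ t → √≈ m (x m) ≤ √≈ n (x n) + t) (halves ε)
        (√≈-step 0<η m n (x m) (x n) (small n ≤n) (∣p-q∣≤r⇒p≤q+r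
          (hN m n (ℕ.m⊔n≤o⇒m≤o N (↧ₙ η) ≤m) (ℕ.m⊔n≤o⇒m≤o N (↧ₙ η) ≤n))))
  in N ℕ.⊔ ↧ₙ η , λ m n ≤m ≤n → ∣p-q∣≤r (step m n ≤m ≤n) (step n m ≤n ≤m)

√≈-square : ∀ (f : ℕ → ℚ) ε → 0ℚ < ε →
  ∃[ B ] 0ℚ < B × ∃[ N ] (∀ n → N ℕ.≤ n → ∣ √≈ n (f n) ∣ ≤ B) →
  ∃[ N ] (∀ n → N ℕ.≤ n → 0ℚ ≤ f n + ε) →
  ∃[ N ] (∀ n → N ℕ.≤ n → ∣ √≈ n (f n) * √≈ n (f n) - f n ∣ ≤ ε)
√≈-square f ε 0<ε (B , 0<B , M , hM) (L , hL) = M ℕ.⊔ L ℕ.⊔ ↧ₙ η , λ n ≤n →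
  let M≤n = ℕ.m⊔n≤o⇒m≤o M L (ℕ.m⊔n≤o⇒m≤o (M ℕ.⊔ L) (↧ₙ η) ≤n)
      L≤n = ℕ.m⊔n≤o⇒n≤o M L (ℕ.m⊔n≤o⇒m≤o (M ℕ.⊔ L) (↧ₙ η) ≤n)
      δ≤η = 1/suc-≤ 0<η (ℕ.m≤n⇒m≤1+n (ℕ.m⊔n≤o⇒n≤o (M ℕ.⊔ L) (↧ₙ η) ≤n))
  in ∣p-q∣≤r (below n (hL n L≤n) (√≈-lower n (f n))) (above n (hM n M≤n) δ≤η)
  where
  open ℚ.≤-Reasoning
  open +-*-Solver
  C = B + B + 1ℚ
  0<C : 0ℚ < C
  0<C = ℚ.+-mono-< {0ℚ} {B + B} {0ℚ} {1ℚ} (ℚ.+-mono-< {0ℚ} {B} {0ℚ} {B} 0<B 0<B) 0<1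
  instance
    C-pos : Positive C
    C-pos = positive 0<C
    C-nonZero : NonZero C
    C-nonZero = ℚ.pos⇒nonZero C
  η = ε * 1/ C
  0<η : 0ℚ < η
  0<η = *-pos 0<ε (ℚ.positive⁻¹ (1/ C) {{ℚ.1/pos⇒pos C}})
  below : ∀ n → 0ℚ ≤ f n + ε → √≈ n (f n) ≡ 0ℚ ⊎ √≈ n (f n) * √≈ n (f n) ≤ f n →
    √≈ n (f n) * √≈ n (f n) ≤ f n + ε
  below n h (inj₁ eq) = subst (λ s → s * s ≤ f n + ε) (sym eq) h
  below n h (inj₂ s²≤fn) = begin
    √≈ n (f n) * √≈ n (f n)  ≤⟨ s²≤fn ⟩
    f n                      ≡⟨ ℚ.+-identityʳ (f n) ⟨
    f n + 0ℚ                 ≤⟨ ℚ.+-monoʳ-≤ (f n) (ℚ.<⇒≤ 0<ε) ⟩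
    f n + ε                  ∎
  above : ∀ n → ∣ √≈ n (f n) ∣ ≤ B → 1/suc n ≤ η →
    f n ≤ √≈ n (f n) * √≈ n (f n) + ε
  above n ∣s∣≤B δ≤η = begin
    f n                          ≤⟨ ℚ.<⇒≤ (√≈-upper n (f n)) ⟩
    (s + δ) * (s + δ)            ≡⟨ solve 2 (λ s d →
      (s :+ d) :* (s :+ d) := s :* s :+ (s :+ s :+ d) :* d) refl s δ ⟩
    s * s + (s + s + δ) * δ      ≤⟨ ℚ.+-monoʳ-≤ (s * s) (*-mono-≤-nonNeg
      (ℚ.<⇒≤ (0<1/suc n)) (ℚ.<⇒≤ 0<C) (ℚ.+-mono-≤ (ℚ.+-mono-≤ s≤B s≤B) δ≤1) δ≤η) ⟩
    s * s + C * η                ≡⟨ cong (λ t → s * s + t) (solve 3 (λ c e i →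
      c :* (e :* i) := e :* (c :* i)) refl C ε (1/ C)) ⟩
    s * s + ε * (C * 1/ C)       ≡⟨ cong (λ t → s * s + ε * t) (ℚ.*-inverseʳ C) ⟩
    s * s + ε * 1ℚ               ≡⟨ cong (λ t → s * s + t) (ℚ.*-identityʳ ε) ⟩
    s * s + ε                    ∎
    where
    s = √≈ n (f n)
    δ = 1/suc n
    s≤B = ℚ.≤-trans (p≤∣p∣ s) ∣s∣≤B
    δ≤1 : δ ≤ 1ℚ
    δ≤1 = 1/suc-≤ 0<1 {n} (ℕ.s≤s ℕ.z≤n)

√-square : ∀ x → 0ℝ ≤ℝ x → √ x *ℝ √ x ≈ℝ x
√-square x 0≤x ε 0<ε =
  √≈-square (seq x) ε 0<ε (eventuallyBounded (cauchy (√ x))) (0≤x ε 0<ε)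

0≤√ : ∀ x → 0ℝ ≤ℝ √ x
0≤√ (mkℝ f _) ε 0<ε = 0 , λ n _ →
  ℚ.+-mono-≤ {0ℚ} {√≈ n (f n)} {0ℚ} {ε} (0≤√≈ n (f n)) (ℚ.<⇒≤ 0<ε)

infix 4 _≈ℂ_
infixl 7 _*ℂ_
infixl 6 _+ℂ_

record ℂ : Set where
  constructor _+i_
  field
    Re : ℝ
    Im : ℝ

open ℂ public

_≈ℂ_ : ℂ → ℂ → Set
z ≈ℂ w = Re z ≈ℝ Re w × Im z ≈ℝ Im w

fromℝ : ℝ → ℂ
fromℝ x = x +i 0ℝ

0ℂ : ℂ
0ℂ = fromℝ 0ℝ

_+ℂ_ : ℂ → ℂ → ℂ
z +ℂ w = (Re z +ℝ Re w) +i (Im z +ℝ Im w)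

_*ℂ_ : ℂ → ℂ → ℂ
z *ℂ w = (Re z *ℝ Re w -ℝ Im z *ℝ Im w) +i (Re z *ℝ Im w +ℝ Im z *ℝ Re w)

∣_∣ℂ : ℂ → ℝ
∣ z ∣ℂ = √ (Re z *ℝ Re z +ℝ Im z *ℝ Im z)

ℕ→ℝ : ℕ → ℝ
ℕ→ℝ n = fromℚ (fromℕ n)

ℕ→ℂ : ℕ → ℂ
ℕ→ℂ n = fromℝ (ℕ→ℝ n)

-- Coefficients, constant term first.
Polynomial : Set
Polynomial = List ℂ

eval : Polynomial → ℂ → ℂ
eval p z = foldr (λ a v → a +ℂ z *ℂ v) 0ℂ p

-- One-line notation is indexed from 1, so π_j is the value of π at the
-- element of Fin n with toℕ equal to j - 1.
IsDescent : ∀ {n} → Permutation′ n → ℕ → Set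
IsDescent {n} π j = Σ (Fin n) λ i → Σ (Fin n) λ i′ →
  suc (toℕ i) ≡ j × suc (toℕ i′) ≡ suc j × π ⟨$⟩ʳ i Fin.> π ⟨$⟩ʳ i′

HasDescentSet : List ℕ → ∀ {n} → Permutation′ n → Set
HasDescentSet I π = ∀ j → IsDescent π j ⇔ j ∈ I

-- Permutations are compared by their values, since functions (and the
-- proofs that they are invertible) have no extensional _≡_.
PermutationsWithDescentSet : List ℕ → ℕ → Setoid 0ℓ 0ℓ
PermutationsWithDescentSet I n = record
  { Carrier       = Σ (Permutation′ n) (HasDescentSet I)
  ; _≈_           = λ (π , _) (σ , _) → π Perm.≈ σ
  ; isEquivalence = record
    { refl  = λ _ → refl
    ; sym   = λ π≈σ i → sym (π≈σ i)
    ; trans = λ π≈σ σ≈τ i → trans (π≈σ i) (σ≈τ i)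
    }
  }

HasCardinality : Setoid 0ℓ 0ℓ → ℕ → Set
HasCardinality S k = Bijection (setoid (Fin k)) S

-- The finite set I of positive integers is given by a list of its elements,
-- so max 0 I is max (I ∪ {0}). At most one polynomial (up to _≈ℂ_ and trailing zero
-- coefficients) satisfies this, as infinitely many of its values are prescribed;
-- eval d z is then d(I; z).
IsDescentPolynomial : List ℕ → Polynomial → Set
IsDescentPolynomial I d = ∀ n → n ℕ.> max 0 I →
  ∃[ k ] HasCardinality (PermutationsWithDescentSet I n) k × eval d (ℕ→ℂ n) ≈ℂ ℕ→ℂ k

{-# OPTIONS --safe #-}
-- A permutation whose descents all lie at m is a shuffle of two increasing blocks, so there are
-- n C m of them, and n C m ∸ 1 with a descent at m. As a polynomial vanishing at all large integers
-- vanishes everywhere, a root z of d satisfies z (z - 1) ⋯ (z - m + 1) = m!. If |z| > m then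
-- |z - j| ≥ |z| - j > m - j, and if Re z < -1 then |z - j| ≥ j - Re z > j + 1, for 0 ≤ j < m; in
-- both cases the product of the factors has absolute value greater than m!.
module Submission where

open import Defs
open import Algebra.Bundles using (CommutativeRing)
import Algebra.Properties.Ring as RingProperties
import Algebra.Solver.Ring.NaturalCoefficients.Default as SemiringSolver
open import Data.Fin.Base as Fin using (Fin; zero; suc; toℕ; punchOut; splitAt; join; _↑ˡ_; _↑ʳ_)
open import Data.Fin.Permutation using (Permutation′; permutation; _⟨$⟩ʳ_; _⟨$⟩ˡ_; inverseˡ; inverseʳ)
  renaming (_≈_ to _≈ₚ_; id to idₚ)
import Data.Fin.Properties as Fin
open import Data.List.Base using ([_]; []; _∷_)
open import Data.List.Extrema.Nat using (max<v⁺)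
open import Data.List.Relation.Unary.All using ([]; _∷_)
open import Data.List.Relation.Unary.Any using (here)
open import Data.Nat.Base as ℕ using (ℕ; zero; suc; _≥_; _!; _∸_; s≤s; z≤n)
open import Data.Nat.Combinatorics using (_C_; nCn≡1; nCk+nC[k+1]≡[n+1]C[k+1]; nCk≡nPk/k!; nPk≡n!/[n∸k]!)
open import Data.Nat.Combinatorics.Base using (_P′_)
open import Data.Nat.Combinatorics.Specification using (nP′n≡n!; nP′k≡n!/[n∸k]!; k!∣nP′k)
open import Data.Nat.DivMod using (_/_; m/n*n≡m; /-congˡ)
import Data.Nat.Properties as ℕ
open import Data.Product.Base using (∃-syntax; Σ-syntax; _×_; _,_; proj₁; proj₂)
open import Data.Sum.Base as Sum using (_⊎_; inj₁; inj₂; [_,_]′)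
open import Data.Sum.Function.Propositional using (_⊎-↔_)
open import Function.Base using (_∘_; id)
open import Function.Bundles using (_↔_; mk↔ₛ′; mk⇔; Inverse; Injection; Bijection; Equivalence)
open import Function.Construct.Composition using (_↔-∘_)
open import Function.Construct.Symmetry using (↔-sym)
open import Function.Properties.Inverse using (↔⇒↣)
open import Level using (0ℓ; _⊔_)
import Relation.Binary.PropositionalEquality as ≡
import Relation.Binary.Reasoning.Setoid as ≈-Reasoning
open import Relation.Nullary using (¬_; Dec; yes; no; contradiction; _×-dec_)

-- Order on constructive reals is not decidable, so `|z| > m` is never a case to distinguish. Both
-- bounds are instead read off at a single index `n` of the approximating rational sequences, where
-- `<` can be decided: an n-th term violating the bound by more than `ε` pushes the squared modulus
-- of the product of the factors at least `ε` above `(m!)²`, while for large `n` convergence keeps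
-- it within `ε/2`. The gap in one factor survives the product because the bounds `m - j` and
-- `j + 1` are all at least 1. The coefficients of `d` are arbitrary, and the number `k` of
-- permutations is known only through some bijection. Hence polynomials are compared through their
-- values at integers, with a notion of polynomial that mentions no coefficients, and the count is
-- obtained from injections in both directions. The 1 subtracted from the binomial coefficient is
-- the identity permutation.

nCk*k!≡nP′k : ∀ {n k} → k ℕ.≤ n → (n C k) ℕ.* k ! ≡.≡ n P′ k
nCk*k!≡nP′k {n} {k} k≤n = begin
  (n C k) ℕ.* k !           ≡⟨ ≡.cong (ℕ._* k !) (nCk≡nPk/k! k≤n) ⟩
  (_ / k !) ℕ.* k !         ≡⟨ ≡.cong (ℕ._* k !) (/-congˡ {o = k !}
    (≡.trans (nPk≡n!/[n∸k]! k≤n) (≡.sym (nP′k≡n!/[n∸k]! k≤n)))) ⟩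
  ((n P′ k) / k !) ℕ.* k !  ≡⟨ m/n*n≡m (k!∣nP′k k≤n) ⟩
  n P′ k                    ∎
  where
  open ≡.≡-Reasoning
  instance _ = k ℕ.!≢0
           _ = (n ∸ k) ℕ.!≢0

-- Polynomial functions over a commutative ring

module PolynomialFunctions {c ℓ} (R : CommutativeRing c ℓ) where
  open CommutativeRing R
  open SemiringSolver commutativeSemiring using (solve; _:+_; _:*_; _:=_)
  open ≈-Reasoning setoid

  x-y+y≈x : ∀ x y → x - y + y ≈ x
  x-y+y≈x x y = begin
    x - y + y        ≈⟨ +-assoc x (- y) y ⟩
    x + (- y + y)    ≈⟨ +-congˡ (-‿inverseˡ y) ⟩
    x + 0#           ≈⟨ +-identityʳ x ⟩
    x                ∎

  -- Polynomial functions without coefficients: taking divided differences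
  -- q a (z) = (f z - f a) / (z - a) repeatedly leads to zero. In order that only semiring
  -- identities arise, z - a is replaced by any w such that z = w + a.
  data IsPolynomial (f : Carrier → Carrier) : Set (c ⊔ ℓ) where
    vanishing : (∀ z → f z ≈ 0#) → IsPolynomial f
    divided   : (q : Carrier → Carrier → Carrier) → (∀ a → IsPolynomial (q a)) →
                (∀ a z w → z ≈ w + a → f z ≈ f a + w * q a z) → IsPolynomial f

  IsPolynomial-resp : ∀ {f g} → (∀ z → f z ≈ g z) → IsPolynomial f → IsPolynomial g
  IsPolynomial-resp f≈g (vanishing f≈0)   = vanishing λ z → trans (sym (f≈g z)) (f≈0 z)
  IsPolynomial-resp f≈g (divided q qP eq) = divided q qP λ a z w z≈w+a →
    trans (sym (f≈g z)) (trans (eq a z w z≈w+a) (+-congʳ (f≈g a)))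

  const-IsPolynomial : ∀ k → IsPolynomial (λ _ → k)
  const-IsPolynomial k = divided (λ _ _ → 0#) (λ _ → vanishing λ _ → refl) λ a z w _ → sym (begin
    k + w * 0#    ≈⟨ +-congˡ (zeroʳ w) ⟩
    k + 0#        ≈⟨ +-identityʳ k ⟩
    k             ∎)

  +-IsPolynomial : ∀ {f g} → IsPolynomial f → IsPolynomial g → IsPolynomial (λ z → f z + g z)
  +-IsPolynomial (vanishing f≈0) gP =
    IsPolynomial-resp (λ z → sym (trans (+-congʳ (f≈0 z)) (+-identityˡ _))) gP
  +-IsPolynomial fP@(divided _ _ _) (vanishing g≈0) =
    IsPolynomial-resp (λ z → sym (trans (+-congˡ (g≈0 z)) (+-identityʳ _))) fP
  +-IsPolynomial {f} {g} (divided q qP f-eq) (divided r rP g-eq) =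
    divided (λ a z → q a z + r a z) (λ a → +-IsPolynomial (qP a) (rP a)) λ a z w z≈w+a → begin
      f z + g z                                    ≈⟨ +-cong (f-eq a z w z≈w+a) (g-eq a z w z≈w+a) ⟩
      (f a + w * q a z) + (g a + w * r a z)        ≈⟨ solve 5 (λ fa ga w q r →
        (fa :+ w :* q) :+ (ga :+ w :* r) := (fa :+ ga) :+ w :* (q :+ r)) refl (f a) (g a) w (q a z) (r a z) ⟩
      (f a + g a) + w * (q a z + r a z)            ∎

  *ˡ-IsPolynomial : ∀ k {f} → IsPolynomial f → IsPolynomial (λ z → k * f z)
  *ˡ-IsPolynomial k (vanishing f≈0) = vanishing λ z → trans (*-congˡ (f≈0 z)) (zeroʳ k)
  *ˡ-IsPolynomial k {f} (divided q qP eq) =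
    divided (λ a z → k * q a z) (λ a → *ˡ-IsPolynomial k (qP a)) λ a z w z≈w+a → begin
      k * f z                    ≈⟨ *-congˡ (eq a z w z≈w+a) ⟩
      k * (f a + w * q a z)      ≈⟨ solve 4 (λ k fa w q →
        k :* (fa :+ w :* q) := k :* fa :+ w :* (k :* q)) refl k (f a) w (q a z) ⟩
      k * f a + w * (k * q a z)  ∎

  -- Divided difference constantly 1. Only such multipliers occur: `z` itself in Horner's scheme,
  -- and `z - ι k` in a falling factorial.
  IsMonicLinear : (Carrier → Carrier) → Set (c ⊔ ℓ)
  IsMonicLinear l = ∀ a z w → z ≈ w + a → l z ≈ w + l a

  id-IsMonicLinear : IsMonicLinear (λ z → z)
  id-IsMonicLinear a z w z≈w+a = z≈w+a

  translation-IsMonicLinear : ∀ k → IsMonicLinear (_+ k)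
  translation-IsMonicLinear k a z w z≈w+a = trans (+-congʳ z≈w+a) (+-assoc w a k)

  -- Leibniz rule for divided differences, `(l f)[a, z] = l(z) f[a, z] + l[a, z] f(a)` with `l[a, z]
  -- = 1`; the recursion descends from `f` to `f[a, _]`.
  *-IsPolynomial : ∀ {l f} → IsMonicLinear l → IsPolynomial f → IsPolynomial (λ z → l z * f z)
  *-IsPolynomial {l} l-lin (vanishing f≈0) = vanishing λ z → trans (*-congˡ (f≈0 z)) (zeroʳ (l z))
  *-IsPolynomial {l} {f} l-lin (divided q qP eq) =
    divided (λ a z → l z * q a z + f a)
      (λ a → +-IsPolynomial (*-IsPolynomial l-lin (qP a)) (const-IsPolynomial (f a))) λ a z w z≈w+a → begin
      l z * f z                                     ≈⟨ *-cong (l-lin a z w z≈w+a) (eq a z w z≈w+a) ⟩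
      (w + l a) * (f a + w * q a z)                 ≈⟨ solve 4 (λ w la fa q →
        (w :+ la) :* (fa :+ w :* q) := la :* fa :+ w :* ((w :+ la) :* q :+ fa)) refl w (l a) (f a) (q a z) ⟩
      l a * f a + w * ((w + l a) * q a z + f a)     ≈⟨ +-congˡ (*-congˡ (+-congʳ (*-congʳ (l-lin a z w z≈w+a)))) ⟨
      l a * f a + w * (l z * q a z + f a)           ∎

  falling : (ℕ → Carrier) → Carrier → ℕ → Carrier
  falling ι z zero    = 1#
  falling ι z (suc k) = (z - ι k) * falling ι z k

  falling-IsPolynomial : ∀ ι k → IsPolynomial (λ z → falling ι z k)
  falling-IsPolynomial ι zero    = const-IsPolynomial 1#
  falling-IsPolynomial ι (suc k) =
    *-IsPolynomial (translation-IsMonicLinear (- ι k)) (falling-IsPolynomial ι k)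

  module _ (ι : ℕ → Carrier)
           (ι-1 : ι 1 ≈ 1#)
           (ι-+ : ∀ m n → ι (m ℕ.+ n) ≈ ι m + ι n)
           (ι-* : ∀ m n → ι (m ℕ.* n) ≈ ι m * ι n)
           (ι⁻¹ : ℕ → Carrier)
           (ι⁻¹-inverse : ∀ n → ι⁻¹ n * ι (suc n) ≈ 1#) where

    ι-cancel : ∀ n {x} → ι (suc n) * x ≈ 0# → x ≈ 0#
    ι-cancel n {x} ιx≈0 = begin
      x                          ≈⟨ *-identityˡ x ⟨
      1# * x                     ≈⟨ *-congʳ (ι⁻¹-inverse n) ⟨
      ι⁻¹ n * ι (suc n) * x      ≈⟨ *-assoc _ _ _ ⟩
      ι⁻¹ n * (ι (suc n) * x)    ≈⟨ *-congˡ ιx≈0 ⟩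
      ι⁻¹ n * 0#                 ≈⟨ zeroʳ _ ⟩
      0#                         ∎

    -- As `f` vanishes at `ι N` and at `ι (suc d + N)`, so does `ι (suc d)` times the divided
    -- difference at `ι N`; since `ι (suc d)` is invertible, that divided difference vanishes at all
    -- integers beyond `N`. By induction it is zero, and `f` is then constantly `f (ι N)`, which is
    -- 0.
    eventually-0⇒0 : ∀ {f} → IsPolynomial f → ∀ N → (∀ n → N ℕ.≤ n → f (ι n) ≈ 0#) → ∀ z → f z ≈ 0#
    eventually-0⇒0     (vanishing f≈0)   N h z = f≈0 z
    eventually-0⇒0 {f} (divided q qP eq) N h z = begin
      f z                                ≈⟨ eq (ι N) z (z - ι N) (sym (x-y+y≈x z (ι N))) ⟩
      f (ι N) + (z - ι N) * q (ι N) z    ≈⟨ +-cong (h N ℕ.≤-refl) (*-congˡ (eventually-0⇒0 (qP (ι N)) (suc N) q≈0 z)) ⟩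
      0# + (z - ι N) * 0#                ≈⟨ +-identityˡ _ ⟩
      (z - ι N) * 0#                     ≈⟨ zeroʳ _ ⟩
      0#                                 ∎
      where
      q≈0′ : ∀ d → q (ι N) (ι (suc d ℕ.+ N)) ≈ 0#
      q≈0′ d = ι-cancel d (begin
        ι (suc d) * y                ≈⟨ +-identityˡ _ ⟨
        0# + ι (suc d) * y           ≈⟨ +-congʳ (h N ℕ.≤-refl) ⟨
        f (ι N) + ι (suc d) * y      ≈⟨ eq (ι N) _ (ι (suc d)) (ι-+ (suc d) N) ⟨
        f (ι (suc d ℕ.+ N))          ≈⟨ h _ (ℕ.m≤n+m N (suc d)) ⟩
        0#                           ∎)
        where y = q (ι N) (ι (suc d ℕ.+ N))
      q≈0 : ∀ n → suc N ℕ.≤ n → q (ι N) (ι n) ≈ 0#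
      q≈0 n N<n = ≡.subst (λ k → q (ι N) (ι k) ≈ 0#)
        (≡.trans (≡.sym (ℕ.+-suc (n ∸ suc N) N)) (ℕ.m∸n+n≡m N<n)) (q≈0′ (n ∸ suc N))

    eventually-≈⇒≈ : ∀ {f g} → IsPolynomial f → IsPolynomial g →
      ∀ N → (∀ n → N ℕ.≤ n → f (ι n) ≈ g (ι n)) → ∀ z → f z ≈ g z
    eventually-≈⇒≈ {f} {g} fP gP N h z = begin
      f z                        ≈⟨ x-y+y≈x (f z) (g z) ⟨
      f z - g z + g z            ≈⟨ +-congʳ (+-congˡ (-1*g z)) ⟨
      f z + - 1# * g z + g z     ≈⟨ +-congʳ (eventually-0⇒0 (+-IsPolynomial fP (*ˡ-IsPolynomial (- 1#) gP)) N
        (λ n N≤n → trans (+-cong (h n N≤n) (-1*g (ι n))) (-‿inverseʳ (g (ι n)))) z) ⟩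
      0# + g z                   ≈⟨ +-identityˡ (g z) ⟩
      g z                        ∎
      where
      -1*g : ∀ z → - 1# * g z ≈ - g z
      -1*g z = RingProperties.-1*x≈-x ring (g z)

    falling-ι : ∀ n k → k ℕ.≤ n → falling ι (ι n) k ≈ ι (n P′ k)
    falling-ι n zero    _   = sym ι-1
    falling-ι n (suc k) k<n = begin
      (ι n - ι k) * falling ι (ι n) k    ≈⟨ *-cong ι-∸ (falling-ι n k (ℕ.<⇒≤ k<n)) ⟩
      ι (n ∸ k) * ι (n P′ k)             ≈⟨ ι-* (n ∸ k) (n P′ k) ⟨
      ι ((n ∸ k) ℕ.* (n P′ k))           ∎
      where
      ι-∸ : ι n - ι k ≈ ι (n ∸ k)
      ι-∸ = begin
        ι n - ι k                  ≈⟨ +-congʳ (reflexive (≡.cong ι (ℕ.m∸n+n≡m (ℕ.<⇒≤ k<n)))) ⟨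
        ι (n ∸ k ℕ.+ k) - ι k      ≈⟨ +-congʳ (ι-+ (n ∸ k) k) ⟩
        ι (n ∸ k) + ι k - ι k      ≈⟨ +-assoc _ _ _ ⟩
        ι (n ∸ k) + (ι k - ι k)    ≈⟨ +-congˡ (-‿inverseʳ (ι k)) ⟩
        ι (n ∸ k) + 0#             ≈⟨ +-identityʳ _ ⟩
        ι (n ∸ k)                  ∎

    -- `m! (1 + f)` agrees with the falling factorial at every integer `n > m`, because `m!` times
    -- `n C m` is `n P′ m`; so they agree at a root of `f`, where the former is `m!`. Clearing the
    -- denominator and moving the 1 across avoids both division and truncated subtraction.
    binomial-1-root : ∀ m {f} → IsPolynomial f →
      (∀ n → m ℕ.< n → ∃[ k ] suc k ≡.≡ n C m × f (ι n) ≈ ι k) →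
      ∀ z → f z ≈ 0# → falling ι z m ≈ ι (m !)
    binomial-1-root m {f} fP values z f≈0 = begin
      falling ι z m                      ≈⟨ eventually-≈⇒≈
        (*ˡ-IsPolynomial (ι (m !)) (+-IsPolynomial (const-IsPolynomial 1#) (fP)))
        (falling-IsPolynomial ι m) (suc m) agree z ⟨
      ι (m !) * (1# + f z)    ≈⟨ *-congˡ (trans (+-congˡ f≈0) (+-identityʳ 1#)) ⟩
      ι (m !) * 1#                     ≈⟨ *-identityʳ _ ⟩
      ι (m !)                          ∎
      where
      agree : ∀ n → m ℕ.< n → ι (m !) * (1# + f (ι n)) ≈ falling ι (ι n) m
      agree n m<n with k , suc-k≡ , f≈k ← values n m<n = begin
        ι (m !) * (1# + f (ι n))  ≈⟨ *-congˡ (+-cong (sym ι-1) f≈k) ⟩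
        ι (m !) * (ι 1 + ι k)              ≈⟨ *-congˡ (ι-+ 1 k) ⟨
        ι (m !) * ι (suc k)                ≈⟨ *-comm _ _ ⟩
        ι (suc k) * ι (m !)                ≈⟨ ι-* (suc k) (m !) ⟨
        ι (suc k ℕ.* m !)                  ≡⟨ ≡.cong (λ c → ι (c ℕ.* m !)) suc-k≡ ⟩
        ι ((n C m) ℕ.* m !)                ≡⟨ ≡.cong ι (nCk*k!≡nP′k (ℕ.<⇒≤ m<n)) ⟩
        ι (n P′ m)                         ≈⟨ falling-ι n m (ℕ.<⇒≤ m<n) ⟨
        falling ι (ι n) m                    ∎

-- Permutations with descents at most at m

open ≡ using (_≡_; _≢_; refl; sym; trans; cong; subst; subst₂)

Mono : ∀ {p n} → (Fin p → Fin n) → Set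
Mono f = ∀ {i j} → i Fin.< j → f i Fin.< f j

ascending-steps⇒Mono : ∀ {p n} (f : Fin p → Fin n) →
  (∀ i j → suc (toℕ i) ≡ toℕ j → f i Fin.< f j) → Mono f
ascending-steps⇒Mono f step {zero}  {suc zero}    _         = step zero (suc zero) refl
ascending-steps⇒Mono f step {zero}  {suc (suc j)} _         = Fin.<-trans
  (step zero (suc zero) refl)
  (ascending-steps⇒Mono (f ∘ suc) (λ i k eq → step (suc i) (suc k) (cong suc eq)) {zero} {suc j} (s≤s z≤n))
ascending-steps⇒Mono f step {suc i} {suc j}       (s≤s i<j) =
  ascending-steps⇒Mono (f ∘ suc) (λ i k eq → step (suc i) (suc k) (cong suc eq)) {i} {j} i<j

-- A word with p letters left and q letters right: its v-th letter tells
-- which of the two increasing blocks of a permutation contains the value v.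
data Shuffle : ℕ → ℕ → ℕ → Set where
  []    : Shuffle 0 0 0
  left  : ∀ {n p q} → Shuffle n p q → Shuffle (suc n) (suc p) q
  right : ∀ {n p q} → Shuffle n p q → Shuffle (suc n) p (suc q)

lefts : ∀ {n p q} → Shuffle n p q → Fin p → Fin n
lefts (left s)  zero    = zero
lefts (left s)  (suc i) = suc (lefts s i)
lefts (right s) i       = suc (lefts s i)

rights : ∀ {n p q} → Shuffle n p q → Fin q → Fin n
rights (left s)  j       = suc (rights s j)
rights (right s) zero    = zero
rights (right s) (suc j) = suc (rights s j)

locate : ∀ {n p q} → Shuffle n p q → Fin n → Fin p ⊎ Fin q
locate (left s)  zero    = inj₁ zero
locate (left s)  (suc v) = Sum.map₁ suc (locate s v)
locate (right s) zero    = inj₂ zero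
locate (right s) (suc v) = Sum.map₂ suc (locate s v)

lefts-Mono : ∀ {n p q} (s : Shuffle n p q) → Mono (lefts s)
lefts-Mono (left s)  {zero}  {suc j} _         = s≤s z≤n
lefts-Mono (left s)  {suc i} {suc j} (s≤s i<j) = s≤s (lefts-Mono s i<j)
lefts-Mono (right s) i<j                       = s≤s (lefts-Mono s i<j)

rights-Mono : ∀ {n p q} (s : Shuffle n p q) → Mono (rights s)
rights-Mono (left s)  i<j                       = s≤s (rights-Mono s i<j)
rights-Mono (right s) {zero}  {suc j} _         = s≤s z≤n
rights-Mono (right s) {suc i} {suc j} (s≤s i<j) = s≤s (rights-Mono s i<j)

locate-lefts : ∀ {n p q} (s : Shuffle n p q) i → locate s (lefts s i) ≡ inj₁ i
locate-lefts (left s)  zero    = refl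
locate-lefts (left s)  (suc i) rewrite locate-lefts s i = refl
locate-lefts (right s) i       rewrite locate-lefts s i = refl

locate-rights : ∀ {n p q} (s : Shuffle n p q) j → locate s (rights s j) ≡ inj₂ j
locate-rights (left s)  j       rewrite locate-rights s j = refl
locate-rights (right s) zero    = refl
locate-rights (right s) (suc j) rewrite locate-rights s j = refl

place : ∀ {n p q} → Shuffle n p q → Fin p ⊎ Fin q → Fin n
place s = [ lefts s , rights s ]′

locate-place : ∀ {n p q} (s : Shuffle n p q) x → locate s (place s x) ≡ x
locate-place s (inj₁ i) = locate-lefts s i
locate-place s (inj₂ j) = locate-rights s j

place-locate : ∀ {n p q} (s : Shuffle n p q) v → place s (locate s v) ≡ v
place-locate (left s)  zero    = refl
place-locate (left s)  (suc v) with locate s v | place-locate s v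
... | inj₁ i | eq = cong suc eq
... | inj₂ j | eq = cong suc eq
place-locate (right s) zero    = refl
place-locate (right s) (suc v) with locate s v | place-locate s v
... | inj₁ i | eq = cong suc eq
... | inj₂ j | eq = cong suc eq

Shuffle-unique : ∀ {n} (s t : Shuffle n n 0) → s ≡ t
Shuffle-unique []       []       = refl
Shuffle-unique (left s) (left t) = cong left (Shuffle-unique s t)

place-injective : ∀ {n p q} (s t : Shuffle n p q) →
  (∀ i → lefts s i ≡ lefts t i) → (∀ j → rights s j ≡ rights t j) → s ≡ t
place-injective []        []        _  _  = refl
place-injective (left s)  (left t)  hˡ hʳ =
  cong left (place-injective s t (Fin.suc-injective ∘ hˡ ∘ suc) (Fin.suc-injective ∘ hʳ))
place-injective (left s)  (right t) hˡ hʳ = contradiction (hˡ zero) λ ()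
place-injective (right s) (left t)  hˡ hʳ = contradiction (hˡ zero) λ ()
place-injective (right s) (right t) hˡ hʳ =
  cong right (place-injective s t (Fin.suc-injective ∘ hˡ) (Fin.suc-injective ∘ hʳ ∘ suc))

-- Counting shuffles

↔-Fin1 : ∀ {A : Set} → A → (∀ (x y : A) → x ≡ y) → A ↔ Fin 1
↔-Fin1 a irr = mk↔ₛ′ (λ _ → zero) (λ _ → a) (λ { zero → refl }) (irr a)

Fin-cong : ∀ {m n} → m ≡ n → Fin m ↔ Fin n
Fin-cong refl = mk↔ₛ′ id id (λ _ → refl) (λ _ → refl)

-- Pascal's rule: deleting the first letter splits the shuffles into those beginning with `left` and
-- those beginning with `right`.
Shuffle-count : ∀ n p q → p ℕ.+ q ≡ n → Shuffle n p q ↔ Fin (n C p)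
Shuffle-count zero    zero    zero    _  =
  ↔-Fin1 [] Shuffle-unique
Shuffle-count (suc n) zero    (suc q) eq =
  Shuffle-count n zero q (ℕ.suc-injective eq) ↔-∘
  mk↔ₛ′ (λ { (right s) → s }) right (λ _ → refl) (λ { (right s) → refl })
-- With no right letters the second summand disappears; here `p = n`, so both binomial coefficients
-- are 1.
Shuffle-count (suc n) (suc p) zero    eq =
  Fin-cong (trans (trans (cong (n C_) p≡n) (nCn≡1 n))
    (sym (trans (cong (λ k → suc n C suc k) p≡n) (nCn≡1 (suc n))))) ↔-∘
  (Shuffle-count n p zero (ℕ.suc-injective eq) ↔-∘
  mk↔ₛ′ (λ { (left s) → s }) left (λ _ → refl) (λ { (left s) → refl }))
  where
  p≡n : p ≡ n
  p≡n = trans (sym (ℕ.+-identityʳ p)) (ℕ.suc-injective eq)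
Shuffle-count (suc n) (suc p) (suc q) eq =
  Fin-cong (nCk+nC[k+1]≡[n+1]C[k+1] n p) ↔-∘
  (↔-sym Fin.+↔⊎ ↔-∘
  ((Shuffle-count n p (suc q) (ℕ.suc-injective eq) ⊎-↔
    Shuffle-count n (suc p) q (trans (sym (ℕ.+-suc p q)) (ℕ.suc-injective eq))) ↔-∘
  mk↔ₛ′ (λ { (left s) → inj₁ s ; (right s) → inj₂ s }) [ left , right ]′
    (λ { (inj₁ s) → refl ; (inj₂ s) → refl })
    (λ { (left s) → refl ; (right s) → refl })))

-- Coding two complementary increasing blocks by a shuffle

record IsShuffle {n p q} (f : Fin p → Fin n) (g : Fin q → Fin n) : Set where
  field
    f-Mono   : Mono f
    g-Mono   : Mono g
    disjoint : ∀ i j → f i ≢ g j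
    cover    : ∀ v → (∃[ i ] f i ≡ v) ⊎ (∃[ j ] g j ≡ v)

Coded : ∀ {n p q} → (Fin p → Fin n) → (Fin q → Fin n) → Set
Coded {n} {p} {q} f g = Σ[ s ∈ Shuffle n p q ] (∀ i → f i ≡ lefts s i) × (∀ j → g j ≡ rights s j)

IsShuffle-swap : ∀ {n p q} {f : Fin p → Fin n} {g : Fin q → Fin n} → IsShuffle f g → IsShuffle g f
IsShuffle-swap h = record
  { f-Mono   = g-Mono
  ; g-Mono   = f-Mono
  ; disjoint = λ i j → disjoint j i ∘ sym
  ; cover    = Sum.swap ∘ cover
  }
  where open IsShuffle h

Mono-positive : ∀ {n p} {f : Fin (suc p) → Fin (suc n)} → Mono f → ∀ i → zero ≢ f (suc i)
Mono-positive {f = f} f-Mono i eq = contradiction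
  (f-Mono {zero} {suc i} (s≤s z≤n)) (subst (λ v → ¬ (f zero Fin.< v)) eq λ ())

-- An increasing block containing the value 0 has it at its first position; remove that position.
module Peel {n p q} {f : Fin (suc p) → Fin (suc n)} {g : Fin q → Fin (suc n)}
            (h : IsShuffle f g) (f0≡0 : f zero ≡ zero) where
  open IsShuffle h

  f′-positive : ∀ i → zero ≢ f (suc i)
  f′-positive = Mono-positive f-Mono

  g-positive : ∀ j → zero ≢ g j
  g-positive j eq = disjoint zero j (trans f0≡0 eq)

  f′ : Fin p → Fin n
  f′ i = punchOut (f′-positive i)

  g′ : Fin q → Fin n
  g′ j = punchOut (g-positive j)

  suc-f′ : ∀ i → suc (f′ i) ≡ f (suc i)
  suc-f′ i = Fin.punchIn-punchOut (f′-positive i)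

  suc-g′ : ∀ j → suc (g′ j) ≡ g j
  suc-g′ j = Fin.punchIn-punchOut (g-positive j)

  f′-g′-IsShuffle : IsShuffle f′ g′
  f′-g′-IsShuffle = record
    { f-Mono   = λ {i} {j} i<j → ℕ.s<s⁻¹ (subst₂ Fin._<_ (sym (suc-f′ i)) (sym (suc-f′ j)) (f-Mono (s≤s i<j)))
    ; g-Mono   = λ {i} {j} i<j → ℕ.s<s⁻¹ (subst₂ Fin._<_ (sym (suc-g′ i)) (sym (suc-g′ j)) (g-Mono i<j))
    ; disjoint = λ i j eq → disjoint (suc i) j (trans (sym (suc-f′ i)) (trans (cong suc eq) (suc-g′ j)))
    ; cover    = λ v → cover′ v (cover (suc v))
    }
    where
    cover′ : ∀ v → (∃[ i ] f i ≡ suc v) ⊎ (∃[ j ] g j ≡ suc v) → (∃[ i ] f′ i ≡ v) ⊎ (∃[ j ] g′ j ≡ v)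
    cover′ v (inj₁ (zero  , eq)) = contradiction (trans (sym f0≡0) eq) λ ()
    cover′ v (inj₁ (suc i , eq)) = inj₁ (i , Fin.suc-injective (trans (suc-f′ i) eq))
    cover′ v (inj₂ (j     , eq)) = inj₂ (j , Fin.suc-injective (trans (suc-g′ j) eq))

attains-0 : ∀ {n p} {f : Fin (suc p) → Fin (suc n)} → Mono f → ∀ i → f i ≡ zero → f zero ≡ zero
attains-0 f-Mono zero    eq = eq
attains-0 f-Mono (suc i) eq = contradiction (sym eq) (Mono-positive f-Mono i)

-- The block that attains the value 0 dictates the first letter. Removing that value and lowering
-- all others by one leaves two complementary increasing blocks for the recursion.
encode : ∀ {n p q} (f : Fin p → Fin n) (g : Fin q → Fin n) → IsShuffle f g → Coded f g
encode {zero} {zero}  {zero}  f g h = [] , (λ ()) , λ ()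
encode {zero} {suc p} {q}     f g h = contradiction (f zero) λ ()
encode {zero} {zero}  {suc q} f g h = contradiction (g zero) λ ()
encode {suc n} f g h = helper f g h (IsShuffle.cover h zero)
  where
  helper : ∀ {p q} (f : Fin p → Fin (suc n)) (g : Fin q → Fin (suc n)) → IsShuffle f g →
    (∃[ i ] f i ≡ zero) ⊎ (∃[ j ] g j ≡ zero) → Coded f g
  helper {suc p} f g h (inj₁ (i , eq)) =
    let s , hf , hg = encode f′ g′ f′-g′-IsShuffle
    in left s
     , (λ { zero → f0≡0 ; (suc i) → trans (sym (suc-f′ i)) (cong suc (hf i)) })
     , (λ j → trans (sym (suc-g′ j)) (cong suc (hg j)))
    where
    f0≡0 = attains-0 (IsShuffle.f-Mono h) i eq
    open Peel h f0≡0
  -- `Peel` takes the block containing 0 first, so the blocks are exchanged: `f′` is now what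
  -- remains of `g`, and `g′` is `f` lowered.
  helper {q = suc q} f g h (inj₂ (j , eq)) =
    let s , hf , hg = encode g′ f′ (IsShuffle-swap f′-g′-IsShuffle)
    in right s
     , (λ i → trans (sym (suc-g′ i)) (cong suc (hf i)))
     , (λ { zero → g0≡0 ; (suc j) → trans (sym (suc-f′ j)) (cong suc (hg j)) })
    where
    g0≡0 = attains-0 (IsShuffle.g-Mono h) j eq
    open Peel (IsShuffle-swap h) g0≡0

-- Permutations and shuffles

⟨$⟩ʳ-injective : ∀ {n} (π : Permutation′ n) {i j} → π ⟨$⟩ʳ i ≡ π ⟨$⟩ʳ j → i ≡ j
⟨$⟩ʳ-injective π = Injection.injective (↔⇒↣ π)

IsDescent? : ∀ {n} (π : Permutation′ n) j → Dec (IsDescent π j)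
IsDescent? π j = Fin.any? λ i → Fin.any? λ i′ →
  (suc (toℕ i) ℕ.≟ j) ×-dec (suc (toℕ i′) ℕ.≟ suc j) ×-dec ((π ⟨$⟩ʳ i′) Fin.<? (π ⟨$⟩ʳ i))

ascent : ∀ {n} (π : Permutation′ n) i i′ → suc (toℕ i) ≡ toℕ i′ →
  ¬ IsDescent π (suc (toℕ i)) → π ⟨$⟩ʳ i Fin.< π ⟨$⟩ʳ i′
ascent π i i′ eq ¬d = Fin.≤∧≢⇒<
  (ℕ.≮⇒≥ λ lt → ¬d (i , i′ , refl , cong suc (sym eq) , lt))
  λ eq′ → ℕ.1+n≢n (trans eq (cong toℕ (sym (⟨$⟩ʳ-injective π eq′))))

-- With an empty second block, both `π` and the identity are coded by words without right letters,
-- and there is only one such word of each length.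
Mono-permutation⇒id : ∀ {n} (π : Permutation′ n) → Mono (π ⟨$⟩ʳ_) → ∀ i → π ⟨$⟩ʳ i ≡ i
Mono-permutation⇒id {n} π π-Mono i =
  let s , hs , _ = encode (π ⟨$⟩ʳ_) (λ ()) record
        { f-Mono = π-Mono ; g-Mono = λ { {()} } ; disjoint = λ _ () ; cover = λ v → inj₁ (π ⟨$⟩ˡ v , inverseʳ π) }
      t , ht , _ = encode {n} {n} id (λ ()) record
        { f-Mono = id ; g-Mono = λ { {()} } ; disjoint = λ _ () ; cover = λ v → inj₁ (v , refl) }
  in trans (hs i) (trans (cong (λ u → lefts u i) (Shuffle-unique s t)) (sym (ht i)))

DescentsWithin : ∀ {n} → ℕ → Permutation′ n → Set
DescentsWithin m π = ∀ j → IsDescent π j → j ≡ m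

no-descents⇒id : ∀ {n m} (π : Permutation′ n) → DescentsWithin m π → ¬ IsDescent π m → ∀ i → π ⟨$⟩ʳ i ≡ i
no-descents⇒id π within ¬d = Mono-permutation⇒id π
  (ascending-steps⇒Mono (π ⟨$⟩ʳ_) λ i j eq → ascent π i j eq λ d → ¬d (subst (IsDescent π) (within _ d) d))

id-no-descent : ∀ {n} (π : Permutation′ n) → (∀ i → π ⟨$⟩ʳ i ≡ i) → ∀ j → ¬ IsDescent π j
id-no-descent π π≈id j (i , i′ , eq , eq′ , gt) = ℕ.<-asym
  (subst₂ Fin._<_ (π≈id i′) (π≈id i) gt)
  (ℕ.≤-reflexive (trans eq (sym (ℕ.suc-injective eq′))))

-- Writing the length as `m + q` lets `splitAt m` separate the positions before a possible descent
-- at `m` from those after it.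
module Blocks (m q : ℕ) where

  toPermutation : Shuffle (m ℕ.+ q) m q → Permutation′ (m ℕ.+ q)
  toPermutation s = permutation (place s ∘ splitAt m) (join m q ∘ locate s)
    (λ v → trans (cong (place s) (Fin.splitAt-join m q (locate s v))) (place-locate s v))
    (λ i → trans (cong (join m q) (locate-place s (splitAt m i))) (Fin.join-splitAt m q i))

  toPermutation-↑ˡ : ∀ s i → toPermutation s ⟨$⟩ʳ (i ↑ˡ q) ≡ lefts s i
  toPermutation-↑ˡ s i = cong (place s) (Fin.splitAt-↑ˡ m i q)

  toPermutation-↑ʳ : ∀ s j → toPermutation s ⟨$⟩ʳ (m ↑ʳ j) ≡ rights s j
  toPermutation-↑ʳ s j = cong (place s) (Fin.splitAt-↑ʳ m q j)

  toPermutation-injective : ∀ s t → toPermutation s ≈ₚ toPermutation t → s ≡ t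
  toPermutation-injective s t eq = place-injective s t
    (λ i → trans (sym (toPermutation-↑ˡ s i)) (trans (eq (i ↑ˡ q)) (toPermutation-↑ˡ t i)))
    (λ j → trans (sym (toPermutation-↑ʳ s j)) (trans (eq (m ↑ʳ j)) (toPermutation-↑ʳ t j)))

  data Position : Fin (m ℕ.+ q) → Set where
    inˡ : ∀ i → Position (i ↑ˡ q)
    inʳ : ∀ j → Position (m ↑ʳ j)

  position : ∀ i → Position i
  position i with splitAt m i in eq
  ... | inj₁ j = subst Position (Fin.splitAt⁻¹-↑ˡ eq) (inˡ j)
  ... | inj₂ j = subst Position (Fin.splitAt⁻¹-↑ʳ eq) (inʳ j)

  toPermutation-DescentsWithin : ∀ s → DescentsWithin m (toPermutation s)
  toPermutation-DescentsWithin s j (i , i′ , eq , eq′ , gt) =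
    helper (position i) (position i′) eq (ℕ.suc-injective eq′) gt
    where
    helper : ∀ {i i′} → Position i → Position i′ → suc (toℕ i) ≡ j → toℕ i′ ≡ j →
      toPermutation s ⟨$⟩ʳ i Fin.> toPermutation s ⟨$⟩ʳ i′ → j ≡ m
    helper (inˡ a) (inˡ b) refl eq′ gt = contradiction
      (subst₂ Fin._<_ (toPermutation-↑ˡ s b) (toPermutation-↑ˡ s a) gt)
      (ℕ.<-asym (lefts-Mono s (ℕ.≤-reflexive
        (trans (cong suc (sym (Fin.toℕ-↑ˡ a q))) (trans (sym eq′) (Fin.toℕ-↑ˡ b q))))))
    -- The only pair of neighbours that can descend straddles the border: `j` is `suc (toℕ a)`, at
    -- most `m`, and also `m + toℕ b`, at least `m`.
    helper (inˡ a) (inʳ b) refl eq′ gt = ℕ.≤-antisym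
      (subst (λ k → suc k ℕ.≤ m) (sym (Fin.toℕ-↑ˡ a q)) (Fin.toℕ<n a))
      (subst (m ℕ.≤_) (trans (sym (Fin.toℕ-↑ʳ m b)) eq′) (ℕ.m≤m+n m (toℕ b)))
    helper (inʳ a) (inˡ b) refl eq′ gt = contradiction
      (ℕ.<-trans (subst (λ k → suc k ℕ.≤ m) (trans (sym (Fin.toℕ-↑ˡ b q)) eq′) (Fin.toℕ<n b))
        (s≤s (subst (m ℕ.≤_) (sym (Fin.toℕ-↑ʳ m a)) (ℕ.m≤m+n m (toℕ a)))))
      (ℕ.<-irrefl refl)
    helper (inʳ a) (inʳ b) refl eq′ gt = contradiction
      (subst₂ Fin._<_ (toPermutation-↑ʳ s b) (toPermutation-↑ʳ s a) gt)
      (ℕ.<-asym (rights-Mono s (ℕ.+-cancelˡ-< m _ _ (ℕ.≤-reflexive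
        (trans (cong suc (sym (Fin.toℕ-↑ʳ m a))) (trans (sym eq′) (Fin.toℕ-↑ʳ m b)))))))

  -- A step inside the first block sits at a one-based position below `m`, a step inside the second
  -- at one above `m`; neither may be a descent.
  blocks-IsShuffle : ∀ π → DescentsWithin m π →
    IsShuffle (λ i → π ⟨$⟩ʳ (i ↑ˡ q)) (λ j → π ⟨$⟩ʳ (m ↑ʳ j))
  blocks-IsShuffle π within = record
    { f-Mono   = ascending-steps⇒Mono _ λ i j eq → ascent π _ _
        (trans (cong suc (Fin.toℕ-↑ˡ i q)) (trans eq (sym (Fin.toℕ-↑ˡ j q))))
        λ d → ℕ.<-irrefl (trans (cong suc (sym (Fin.toℕ-↑ˡ i q))) (within _ d))
          (subst (ℕ._< m) (sym eq) (Fin.toℕ<n j))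
    ; g-Mono   = ascending-steps⇒Mono _ λ i j eq → ascent π _ _
        (trans (cong suc (Fin.toℕ-↑ʳ m i)) (trans (sym (ℕ.+-suc m (toℕ i)))
          (trans (cong (m ℕ.+_) eq) (sym (Fin.toℕ-↑ʳ m j)))))
        λ d → ℕ.<-irrefl (sym (within _ d))
          (s≤s (subst (m ℕ.≤_) (sym (Fin.toℕ-↑ʳ m i)) (ℕ.m≤m+n m (toℕ i))))
    ; disjoint = λ i j eq → ℕ.<-irrefl
        (trans (sym (Fin.toℕ-↑ˡ i q)) (trans (cong toℕ (⟨$⟩ʳ-injective π eq)) (Fin.toℕ-↑ʳ m j)))
        (ℕ.<-≤-trans (Fin.toℕ<n i) (ℕ.m≤m+n m (toℕ j)))
    ; cover    = λ v → cover v (position (π ⟨$⟩ˡ v)) (inverseʳ π)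
    }
    where
    cover : ∀ v {i} → Position i → π ⟨$⟩ʳ i ≡ v →
      (∃[ i ] π ⟨$⟩ʳ (i ↑ˡ q) ≡ v) ⊎ (∃[ j ] π ⟨$⟩ʳ (m ↑ʳ j) ≡ v)
    cover v (inˡ i) eq = inj₁ (i , eq)
    cover v (inʳ j) eq = inj₂ (j , eq)

  fromPermutation : ∀ π → DescentsWithin m π → Shuffle (m ℕ.+ q) m q
  fromPermutation π within = proj₁ (encode _ _ (blocks-IsShuffle π within))

  fromPermutation-injective : ∀ π ρ (hπ : DescentsWithin m π) (hρ : DescentsWithin m ρ) →
    fromPermutation π hπ ≡ fromPermutation ρ hρ → π ≈ₚ ρ
  fromPermutation-injective π ρ hπ hρ eq i = helper (position i)
    where
    cπ = proj₂ (encode _ _ (blocks-IsShuffle π hπ))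
    cρ = proj₂ (encode _ _ (blocks-IsShuffle ρ hρ))
    helper : ∀ {i} → Position i → π ⟨$⟩ʳ i ≡ ρ ⟨$⟩ʳ i
    helper (inˡ i) = trans (proj₁ cπ i) (trans (cong (λ s → lefts s i) eq) (sym (proj₁ cρ i)))
    helper (inʳ j) = trans (proj₂ cπ j) (trans (cong (λ s → rights s j) eq) (sym (proj₂ cρ j)))

  within : ∀ (π : Permutation′ (m ℕ.+ q)) → HasDescentSet [ m ] π → DescentsWithin m π
  within π h j d with here eq ← Equivalence.to (h j) d = eq

  descent-at-m : ∀ (π : Permutation′ (m ℕ.+ q)) → HasDescentSet [ m ] π → IsDescent π m
  descent-at-m π h = Equivalence.from (h m) (here refl)

  hasDescentSet : ∀ (π : Permutation′ (m ℕ.+ q)) → DescentsWithin m π → IsDescent π m → HasDescentSet [ m ] π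
  hasDescentSet π w d j = mk⇔ (λ d′ → here (w j d′)) λ { (here refl) → d }

  module _ {k} (card : HasCardinality (PermutationsWithDescentSet [ m ] (m ℕ.+ q)) k) where
    open Bijection card using (to; injective; surjective)

    private
      perm : Fin k → Permutation′ (m ℕ.+ q)
      perm i = proj₁ (to i)

      perm-within : ∀ i → DescentsWithin m (perm i)
      perm-within i = within (perm i) (proj₂ (to i))

      withDescentSet : ∀ s → IsDescent (toPermutation s) m → ∃[ π ] HasDescentSet [ m ] {m ℕ.+ q} π
      withDescentSet s d = toPermutation s , hasDescentSet (toPermutation s) (toPermutation-DescentsWithin s) d

      count = Shuffle-count (m ℕ.+ q) m q refl
      id-within : DescentsWithin m (idₚ {m ℕ.+ q})
      id-within j d = contradiction d (id-no-descent idₚ (λ _ → refl) j)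

      -- The extra index `zero` stands for the identity, which differs from every `perm i` because
      -- those have a descent at `m`.
      shuffle : Fin (suc k) → Shuffle (m ℕ.+ q) m q
      shuffle zero    = fromPermutation idₚ id-within
      shuffle (suc i) = fromPermutation (perm i) (perm-within i)

      id≢ : ∀ i → ¬ (idₚ ≈ₚ perm i)
      id≢ i eq = id-no-descent (perm i) (sym ∘ eq) m (descent-at-m (perm i) (proj₂ (to i)))

      shuffle-injective : ∀ {i j} → shuffle i ≡ shuffle j → i ≡ j
      shuffle-injective {zero}  {zero}  eq = refl
      shuffle-injective {zero}  {suc j} eq =
        contradiction (fromPermutation-injective idₚ (perm j) id-within (perm-within j) eq) (id≢ j)
      shuffle-injective {suc i} {zero}  eq =
        contradiction (fromPermutation-injective idₚ (perm i) id-within (perm-within i) (sym eq)) (id≢ i)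
      shuffle-injective {suc i} {suc j} eq =
        cong suc (injective (fromPermutation-injective (perm i) (perm j) (perm-within i) (perm-within j) eq))

      -- A shuffle whose permutation descends at `m` gets the index of a preimage under the given
      -- bijection; without that descent the permutation is the identity, so `zero` is used for one
      -- shuffle only.
      index : ∀ s → Dec (IsDescent (toPermutation s) m) → Fin (suc k)
      index s (yes d) = suc (proj₁ (surjective (withDescentSet s d)))
      index s (no _)  = zero

      index-injective : ∀ s t ds dt → index s ds ≡ index t dt → s ≡ t
      index-injective s t (yes d) (yes e) eq = toPermutation-injective s t λ i → trans
        (sym (proj₂ (surjective (withDescentSet s d)) refl i))
        (trans (cong (λ x → perm x ⟨$⟩ʳ i) (Fin.suc-injective eq))
          (proj₂ (surjective (withDescentSet t e)) refl i))
      index-injective s t (no ¬d) (no ¬e) eq = toPermutation-injective s t λ i → trans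
        (no-descents⇒id (toPermutation s) (toPermutation-DescentsWithin s) ¬d i)
        (sym (no-descents⇒id (toPermutation t) (toPermutation-DescentsWithin t) ¬e i))

    -- `shuffle` and `index` are both injective, which bounds each cardinality by the other; they
    -- need not be shown mutually inverse.
    suc-cardinality : suc k ≡ (m ℕ.+ q) C m
    suc-cardinality = ℕ.≤-antisym
      (Fin.injective⇒≤ (λ eq → shuffle-injective (Injection.injective (↔⇒↣ count) eq)))
      (Fin.injective⇒≤ {f = λ x → index (Inverse.from count x) (IsDescent? (toPermutation (Inverse.from count x)) m)}
        (λ eq → Injection.injective (↔⇒↣ (↔-sym count)) (index-injective _ _ _ _ eq)))

descentPolynomial-values : ∀ {m n k} → m ℕ.≤ n →
  HasCardinality (PermutationsWithDescentSet [ m ] n) k → suc k ≡ n C m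
descentPolynomial-values {m} {n} {k} m≤n = subst
  (λ n → HasCardinality (PermutationsWithDescentSet [ m ] n) k → suc k ≡ n C m)
  (ℕ.m+[n∸m]≡n m≤n) (Blocks.suc-cardinality m (n ∸ m))

-- Real and complex numbers

open import Data.Rational.Base hiding (_/_; _≥_; truncate; _⊔_)
import Data.Rational.Properties as ℚ
open import Data.Rational.Solver using (module +-*-Solver)
open +-*-Solver using (solve; _:+_; _:*_; _:-_; :-_; _:=_; con)

-- The ring operations act termwise on sequences, so identities over the rationals carry over with
-- no estimate.
pointwise⇒≈ℝ : ∀ {x y} → (∀ n → seq x n ≡ seq y n) → x ≈ℝ y
pointwise⇒≈ℝ {x} {y} eq ε 0<ε = 0 , λ n _ → begin
  ∣ seq x n - seq y n ∣  ≡⟨ cong (λ p → ∣ p - seq y n ∣) (eq n) ⟩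
  ∣ seq y n - seq y n ∣  ≡⟨ cong ∣_∣ (ℚ.+-inverseʳ (seq y n)) ⟩
  0ℚ                     ≤⟨ ℚ.<⇒≤ 0<ε ⟩
  ε                      ∎
  where open ℚ.≤-Reasoning

≈ℝ-sym : ∀ {x y} → x ≈ℝ y → y ≈ℝ x
≈ℝ-sym {x} {y} x≈y ε 0<ε =
  let N , hN = x≈y ε 0<ε
  in N , λ n N≤n → subst (_≤ ε) (∣p-q∣≡∣q-p∣ (seq x n) (seq y n)) (hN n N≤n)

-- Null sequences are closed under addition. Transitivity of `_≈ℝ_` and congruence of `_+ℝ_` are
-- both instances, by splitting a difference in two.
eventually-small-+ : ∀ (f g h : ℕ → ℚ) → (∀ n → h n ≡ f n + g n) →
  (∀ ε → 0ℚ < ε → ∃[ N ] (∀ n → N ℕ.≤ n → ∣ f n ∣ ≤ ε)) →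
  (∀ ε → 0ℚ < ε → ∃[ N ] (∀ n → N ℕ.≤ n → ∣ g n ∣ ≤ ε)) →
  ∀ ε → 0ℚ < ε → ∃[ N ] (∀ n → N ℕ.≤ n → ∣ h n ∣ ≤ ε)
eventually-small-+ f g h eq f→0 g→0 ε 0<ε =
  let M , hM = f→0 (½ * ε) (½-pos 0<ε)
      N , hN = g→0 (½ * ε) (½-pos 0<ε)
  in M ℕ.⊔ N , λ n ≤n → begin
    ∣ h n ∣              ≡⟨ cong ∣_∣ (eq n) ⟩
    ∣ f n + g n ∣        ≤⟨ ℚ.∣p+q∣≤∣p∣+∣q∣ (f n) (g n) ⟩
    ∣ f n ∣ + ∣ g n ∣    ≤⟨ ℚ.+-mono-≤ (hM n (ℕ.m⊔n≤o⇒m≤o M N ≤n)) (hN n (ℕ.m⊔n≤o⇒n≤o M N ≤n)) ⟩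
    ½ * ε + ½ * ε        ≡⟨ halves ε ⟩
    ε                    ∎
  where open ℚ.≤-Reasoning

≈ℝ-trans : ∀ {x y z} → x ≈ℝ y → y ≈ℝ z → x ≈ℝ z
≈ℝ-trans {x} {y} {z} = eventually-small-+ _ _ _ λ n →
  solve 3 (λ a b c → a :- c := (a :- b) :+ (b :- c)) refl (seq x n) (seq y n) (seq z n)

+ℝ-cong : ∀ {x x′ y y′} → x ≈ℝ x′ → y ≈ℝ y′ → x +ℝ y ≈ℝ x′ +ℝ y′
+ℝ-cong {x} {x′} {y} {y′} = eventually-small-+ _ _ _ λ n →
  solve 4 (λ a b c d → (a :+ c) :- (b :+ d) := (a :- b) :+ (c :- d)) refl
    (seq x n) (seq x′ n) (seq y n) (seq y′ n)

-ℝ-cong : ∀ {x y} → x ≈ℝ y → -ℝ x ≈ℝ -ℝ y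
-ℝ-cong {x} {y} x≈y ε 0<ε =
  let N , hN = ≈ℝ-sym {x} {y} x≈y ε 0<ε
  in N , λ n N≤n → subst (_≤ ε) (cong ∣_∣
    (solve 2 (λ a b → b :- a := :- a :- (:- b)) refl (seq x n) (seq y n))) (hN n N≤n)

-- The terms of `x` are eventually bounded by some `B`, so closeness `ε / B` of the other factors
-- suffices.
*ℝ-congˡ : ∀ x {y y′} → y ≈ℝ y′ → x *ℝ y ≈ℝ x *ℝ y′
*ℝ-congˡ x {y} {y′} y≈y′ ε 0<ε = bounded (eventuallyBounded (cauchy x))
  where
  open ℚ.≤-Reasoning
  bounded : ∃[ B ] 0ℚ < B × ∃[ N ] (∀ n → N ℕ.≤ n → ∣ seq x n ∣ ≤ B) →
    ∃[ N ] (∀ n → N ℕ.≤ n → ∣ seq x n * seq y n - seq x n * seq y′ n ∣ ≤ ε)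
  bounded (B , 0<B , M , hM) = M ℕ.⊔ N , λ n ≤n → begin
    ∣ seq x n * seq y n - seq x n * seq y′ n ∣   ≡⟨ cong ∣_∣ (solve 3
      (λ a b c → a :* b :- a :* c := a :* (b :- c)) refl (seq x n) (seq y n) (seq y′ n)) ⟩
    ∣ seq x n * (seq y n - seq y′ n) ∣           ≡⟨ ℚ.∣p*q∣≡∣p∣*∣q∣ (seq x n) (seq y n - seq y′ n) ⟩
    ∣ seq x n ∣ * ∣ seq y n - seq y′ n ∣         ≤⟨ *-mono-≤-nonNeg (ℚ.0≤∣p∣ (seq y n - seq y′ n)) (ℚ.<⇒≤ 0<B)
      (hM n (ℕ.m⊔n≤o⇒m≤o M N ≤n)) (hN n (ℕ.m⊔n≤o⇒n≤o M N ≤n)) ⟩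
    B * (ε * 1/ B)                               ≡⟨ solve 3
      (λ b e i → b :* (e :* i) := e :* (b :* i)) refl B ε (1/ B) ⟩
    ε * (B * 1/ B)                               ≡⟨ cong (ε *_) (ℚ.*-inverseʳ B) ⟩
    ε * 1ℚ                                       ≡⟨ ℚ.*-identityʳ ε ⟩
    ε                                            ∎
    where
    instance
      B-pos : Positive B
      B-pos = positive 0<B
      B-nonZero : NonZero B
      B-nonZero = ℚ.pos⇒nonZero B
    close = y≈y′ (ε * 1/ B) (*-pos 0<ε (ℚ.positive⁻¹ (1/ B) {{ℚ.1/pos⇒pos B}}))
    N = proj₁ close
    hN = proj₂ close

*ℝ-cong : ∀ {x x′ y y′} → x ≈ℝ x′ → y ≈ℝ y′ → x *ℝ y ≈ℝ x′ *ℝ y′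
*ℝ-cong {x} {x′} {y} {y′} x≈x′ y≈y′ =
  ≈ℝ-trans {x *ℝ y} {x *ℝ y′} {x′ *ℝ y′} (*ℝ-congˡ x {y} {y′} y≈y′)
    (≈ℝ-trans {x *ℝ y′} {y′ *ℝ x} {x′ *ℝ y′} (comm x y′)
      (≈ℝ-trans {y′ *ℝ x} {y′ *ℝ x′} {x′ *ℝ y′} (*ℝ-congˡ y′ {x} {x′} x≈x′) (comm y′ x′)))
  where
  comm : ∀ x y → x *ℝ y ≈ℝ y *ℝ x
  comm x y = pointwise⇒≈ℝ {x *ℝ y} {y *ℝ x} λ n → ℚ.*-comm (seq x n) (seq y n)

-- The complex numbers as a commutative ring

1ℂ : ℂ
1ℂ = fromℝ 1ℝ

-ℂ_ : ℂ → ℂ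
-ℂ z = (-ℝ Re z) +i (-ℝ Im z)

re im : ℂ → ℕ → ℚ
re z = seq (Re z)
im z = seq (Im z)

pointwise⇒≈ℂ : ∀ z w → (∀ n → re z n ≡ re w n) → (∀ n → im z n ≡ im w n) → z ≈ℂ w
pointwise⇒≈ℂ z w hr hi = pointwise⇒≈ℝ {Re z} {Re w} hr , pointwise⇒≈ℝ {Im z} {Im w} hi

ℂ-commutativeRing : CommutativeRing 0ℓ 0ℓ
ℂ-commutativeRing = record
  { Carrier = ℂ ; _≈_ = _≈ℂ_ ; _+_ = _+ℂ_ ; _*_ = _*ℂ_ ; -_ = -ℂ_ ; 0# = 0ℂ ; 1# = 1ℂ
  ; isCommutativeRing = record
    { isRing = record
      { +-isAbelianGroup = record
        { isGroup = record
          { isMonoid = record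
            { isSemigroup = record
              { isMagma = record
                { isEquivalence = record
                  { refl  = λ {z} → pointwise⇒≈ℂ z z (λ _ → refl) (λ _ → refl)
                  ; sym   = λ {z} {w} (p , q) → ≈ℝ-sym {Re z} {Re w} p , ≈ℝ-sym {Im z} {Im w} q
                  ; trans = λ {u} {v} {w} (p , q) (r , s) →
                      ≈ℝ-trans {Re u} {Re v} {Re w} p r , ≈ℝ-trans {Im u} {Im v} {Im w} q s
                  }
                ; ∙-cong = λ {u} {u′} {v} {v′} (p , q) (r , s) →
                    +ℝ-cong {Re u} {Re u′} {Re v} {Re v′} p r , +ℝ-cong {Im u} {Im u′} {Im v} {Im v′} q s
                }
              ; assoc = λ u v w → pointwise⇒≈ℂ (u +ℂ v +ℂ w) (u +ℂ (v +ℂ w))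
                  (λ n → ℚ.+-assoc (re u n) (re v n) (re w n))
                  (λ n → ℚ.+-assoc (im u n) (im v n) (im w n))
              }
            ; identity =
                (λ z → pointwise⇒≈ℂ (0ℂ +ℂ z) z (λ n → ℚ.+-identityˡ (re z n)) (λ n → ℚ.+-identityˡ (im z n)))
              , (λ z → pointwise⇒≈ℂ (z +ℂ 0ℂ) z (λ n → ℚ.+-identityʳ (re z n)) (λ n → ℚ.+-identityʳ (im z n)))
            }
          ; inverse =
              (λ z → pointwise⇒≈ℂ ((-ℂ z) +ℂ z) 0ℂ (λ n → ℚ.+-inverseˡ (re z n)) (λ n → ℚ.+-inverseˡ (im z n)))
            , (λ z → pointwise⇒≈ℂ (z +ℂ (-ℂ z)) 0ℂ (λ n → ℚ.+-inverseʳ (re z n)) (λ n → ℚ.+-inverseʳ (im z n)))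
          ; ⁻¹-cong = λ {z} {w} (p , q) → -ℝ-cong {Re z} {Re w} p , -ℝ-cong {Im z} {Im w} q
          }
        ; comm = λ z w → pointwise⇒≈ℂ (z +ℂ w) (w +ℂ z)
            (λ n → ℚ.+-comm (re z n) (re w n)) (λ n → ℚ.+-comm (im z n) (im w n))
        }
      ; *-cong = λ {u} {u′} {v} {v′} (p , q) (r , s) →
            +ℝ-cong {Re u *ℝ Re v} {Re u′ *ℝ Re v′} { -ℝ (Im u *ℝ Im v)} { -ℝ (Im u′ *ℝ Im v′)}
              (*ℝ-cong {Re u} {Re u′} {Re v} {Re v′} p r)
              (-ℝ-cong {Im u *ℝ Im v} {Im u′ *ℝ Im v′} (*ℝ-cong {Im u} {Im u′} {Im v} {Im v′} q s))
          , +ℝ-cong {Re u *ℝ Im v} {Re u′ *ℝ Im v′} {Im u *ℝ Re v} {Im u′ *ℝ Re v′}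
              (*ℝ-cong {Re u} {Re u′} {Im v} {Im v′} p s)
              (*ℝ-cong {Im u} {Im u′} {Re v} {Re v′} q r)
      ; *-assoc = λ u v w → pointwise⇒≈ℂ (u *ℂ v *ℂ w) (u *ℂ (v *ℂ w))
          (λ n → solve 6 (λ a b c d e f →
            (a :* c :- b :* d) :* e :- (a :* d :+ b :* c) :* f :=
            a :* (c :* e :- d :* f) :- b :* (c :* f :+ d :* e)) refl
            (re u n) (im u n) (re v n) (im v n) (re w n) (im w n))
          (λ n → solve 6 (λ a b c d e f →
            (a :* c :- b :* d) :* f :+ (a :* d :+ b :* c) :* e :=
            a :* (c :* f :+ d :* e) :+ b :* (c :* e :- d :* f)) refl
            (re u n) (im u n) (re v n) (im v n) (re w n) (im w n))
      ; *-identity =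
          (λ z → *-identityˡ z)
        , (λ z → pointwise⇒≈ℂ (z *ℂ 1ℂ) z
            (λ n → solve 2 (λ a b → a :* con 1ℚ :- b :* con 0ℚ := a) refl (re z n) (im z n))
            (λ n → solve 2 (λ a b → a :* con 0ℚ :+ b :* con 1ℚ := b) refl (re z n) (im z n)))
      ; distrib =
          (λ u v w → pointwise⇒≈ℂ (u *ℂ (v +ℂ w)) (u *ℂ v +ℂ u *ℂ w)
            (λ n → solve 6 (λ a b c d e f →
              a :* (c :+ e) :- b :* (d :+ f) := (a :* c :- b :* d) :+ (a :* e :- b :* f)) refl
              (re u n) (im u n) (re v n) (im v n) (re w n) (im w n))
            (λ n → solve 6 (λ a b c d e f →
              a :* (d :+ f) :+ b :* (c :+ e) := (a :* d :+ b :* c) :+ (a :* f :+ b :* e)) refl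
              (re u n) (im u n) (re v n) (im v n) (re w n) (im w n)))
        , (λ u v w → pointwise⇒≈ℂ ((v +ℂ w) *ℂ u) (v *ℂ u +ℂ w *ℂ u)
            (λ n → solve 6 (λ a b c d e f →
              (c :+ e) :* a :- (d :+ f) :* b := (c :* a :- d :* b) :+ (e :* a :- f :* b)) refl
              (re u n) (im u n) (re v n) (im v n) (re w n) (im w n))
            (λ n → solve 6 (λ a b c d e f →
              (c :+ e) :* b :+ (d :+ f) :* a := (c :* b :+ d :* a) :+ (e :* b :+ f :* a)) refl
              (re u n) (im u n) (re v n) (im v n) (re w n) (im w n)))
      }
    ; *-comm = λ z w → pointwise⇒≈ℂ (z *ℂ w) (w *ℂ z)
        (λ n → solve 4 (λ a b c d → a :* c :- b :* d := c :* a :- d :* b) refl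
          (re z n) (im z n) (re w n) (im w n))
        (λ n → solve 4 (λ a b c d → a :* d :+ b :* c := c :* b :+ d :* a) refl
          (re z n) (im z n) (re w n) (im w n))
    }
  }
  where
  *-identityˡ : ∀ z → 1ℂ *ℂ z ≈ℂ z
  *-identityˡ z = pointwise⇒≈ℂ (1ℂ *ℂ z) z
    (λ n → solve 2 (λ a b → con 1ℚ :* a :- con 0ℚ :* b := a) refl (re z n) (im z n))
    (λ n → solve 2 (λ a b → con 1ℚ :* b :+ con 0ℚ :* a := b) refl (re z n) (im z n))

module ℂRing = CommutativeRing ℂ-commutativeRing
open PolynomialFunctions ℂ-commutativeRing

-- The equation satisfied by a root

ℕ→ℂ-+ : ∀ m n → ℕ→ℂ (m ℕ.+ n) ≈ℂ ℕ→ℂ m +ℂ ℕ→ℂ n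
ℕ→ℂ-+ m n = pointwise⇒≈ℂ (ℕ→ℂ (m ℕ.+ n)) (ℕ→ℂ m +ℂ ℕ→ℂ n) (λ _ → fromℕ-+ m n) (λ _ → refl)

ℕ→ℂ-* : ∀ m n → ℕ→ℂ (m ℕ.* n) ≈ℂ ℕ→ℂ m *ℂ ℕ→ℂ n
ℕ→ℂ-* m n = pointwise⇒≈ℂ (ℕ→ℂ (m ℕ.* n)) (ℕ→ℂ m *ℂ ℕ→ℂ n)
  (λ _ → trans (fromℕ-* m n) (solve 2 (λ a b → a :* b := a :* b :- con 0ℚ :* con 0ℚ) refl (fromℕ m) (fromℕ n)))
  (λ _ → solve 2 (λ a b → con 0ℚ := a :* con 0ℚ :+ con 0ℚ :* b) refl (fromℕ m) (fromℕ n))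

ℕ→ℂ-1 : ℕ→ℂ 1 ≈ℂ 1ℂ
ℕ→ℂ-1 = pointwise⇒≈ℂ (ℕ→ℂ 1) 1ℂ (λ _ → refl) (λ _ → refl)

ℕ→ℂ⁻¹ : ℕ → ℂ
ℕ→ℂ⁻¹ n = fromℝ (fromℚ (1/suc n))

ℕ→ℂ⁻¹-inverse : ∀ n → ℕ→ℂ⁻¹ n *ℂ ℕ→ℂ (suc n) ≈ℂ 1ℂ
ℕ→ℂ⁻¹-inverse n = pointwise⇒≈ℂ (ℕ→ℂ⁻¹ n *ℂ ℕ→ℂ (suc n)) 1ℂ
  (λ _ → trans (solve 2 (λ a b → a :* b :- con 0ℚ :* con 0ℚ := b :* a) refl (1/suc n) (fromℕ (suc n)))
    (fromℕ-*-1/suc n))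
  (λ _ → solve 2 (λ a b → a :* con 0ℚ :+ con 0ℚ :* b := con 0ℚ) refl (1/suc n) (fromℕ (suc n)))

fallingℂ : ℂ → ℕ → ℂ
fallingℂ = falling ℕ→ℂ

-- Proved pointwise, since conversion would also unfold and compare the Cauchy moduli.
eval-∷ : ∀ a p z → a ℂRing.+ (z ℂRing.* eval p z) ≈ℂ eval (a ∷ p) z
eval-∷ a p z = pointwise⇒≈ℂ (a ℂRing.+ (z ℂRing.* eval p z)) (eval (a ∷ p) z) (λ _ → refl) (λ _ → refl)

eval-IsPolynomial : ∀ p → IsPolynomial (eval p)
eval-IsPolynomial []      = vanishing λ _ → pointwise⇒≈ℂ 0ℂ 0ℂ (λ _ → refl) (λ _ → refl)
eval-IsPolynomial (a ∷ p) = IsPolynomial-resp {λ z → a ℂRing.+ (z ℂRing.* eval p z)} {eval (a ∷ p)} (eval-∷ a p)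
  (+-IsPolynomial {λ _ → a} {λ z → z ℂRing.* eval p z} (const-IsPolynomial a)
    (*-IsPolynomial {λ z → z} {eval p} id-IsMonicLinear (eval-IsPolynomial p)))

-- Everything the bounds on `z` require from `d` is contained in this equation.
root⇒falling≈m! : ∀ m d → IsDescentPolynomial [ m ] d →
  ∀ z → eval d z ≈ℂ 0ℂ → fallingℂ z m ≈ℂ ℕ→ℂ (m !)
root⇒falling≈m! m d isDP =
  binomial-1-root ℕ→ℂ ℕ→ℂ-1 ℕ→ℂ-+ ℕ→ℂ-* ℕ→ℂ⁻¹ ℕ→ℂ⁻¹-inverse m (eval-IsPolynomial d) λ n m<n →
    let k , card , d≈k = isDP n (max<v⁺ (ℕ.≤-<-trans z≤n m<n) (m<n ∷ []))
    in k , descentPolynomial-values (ℕ.<⇒≤ m<n) card , d≈k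

-- Absolute values of the falling factorials

∣_∣² : ℂ → ℝ
∣ z ∣² = Re z *ℝ Re z +ℝ Im z *ℝ Im z

∣∣²-cong : ∀ z w → z ≈ℂ w → ∣ z ∣² ≈ℝ ∣ w ∣²
∣∣²-cong z w (p , q) = +ℝ-cong {Re z *ℝ Re z} {Re w *ℝ Re w} {Im z *ℝ Im z} {Im w *ℝ Im w}
  (*ℝ-cong {Re z} {Re w} {Re z} {Re w} p p) (*ℝ-cong {Im z} {Im w} {Im z} {Im w} q q)

-- The two-square identity. Squared moduli are multiplicative exactly at each index, which rounded
-- square roots would not be.
∣∣²-* : ∀ z w n → seq ∣ z *ℂ w ∣² n ≡ seq ∣ z ∣² n * seq ∣ w ∣² n
∣∣²-* z w n = solve 4 (λ a b c d →
  (a :* c :- b :* d) :* (a :* c :- b :* d) :+ (a :* d :+ b :* c) :* (a :* d :+ b :* c) :=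
  (a :* a :+ b :* b) :* (c :* c :+ d :* d)) refl (re z n) (im z n) (re w n) (im w n)

0≤p*p : ∀ p → 0ℚ ≤ p * p
0≤p*p p with ℚ.≤-total 0ℚ p
... | inj₁ 0≤p = subst (_≤ p * p) (ℚ.*-zeroʳ p) (ℚ.*-monoˡ-≤-nonNeg p {{nonNegative 0≤p}} 0≤p)
... | inj₂ p≤0 = subst (_≤ p * p) (ℚ.*-zeroʳ p) (ℚ.*-monoˡ-≤-nonPos p {{nonPositive p≤0}} p≤0)

p≤p+q : ∀ p {q} → 0ℚ ≤ q → p ≤ p + q
p≤p+q p {q} 0≤q = subst (_≤ p + q) (ℚ.+-identityʳ p) (ℚ.+-monoʳ-≤ p 0≤q)

0≤1 : 0ℚ ≤ 1ℚ
0≤1 = ℚ.<⇒≤ 0<1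

-- From `a ≥ 1` follows `r² ≥ a (a + ε) ≥ a² + ε`, and `b² ≥ 1` keeps the excess `ε` from shrinking
-- when `v ≥ b²` is multiplied in.
product-gap : ∀ {ε a b r u v} → 0ℚ ≤ ε → 1ℚ ≤ a → 1ℚ ≤ b → a + ε ≤ r → r * r ≤ u → b * b ≤ v →
  (a * b) * (a * b) + ε ≤ u * v
product-gap {ε} {a} {b} {r} {u} {v} 0≤ε 1≤a 1≤b a+ε≤r r²≤u b²≤v = begin
  (a * b) * (a * b) + ε                    ≡⟨ cong ((a * b) * (a * b) +_) (ℚ.*-identityʳ ε) ⟨
  (a * b) * (a * b) + ε * 1ℚ               ≤⟨ ℚ.+-monoʳ-≤ ((a * b) * (a * b)) (*-mono-≤-nonNeg 0≤1 0≤ε ℚ.≤-refl 1≤b²) ⟩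
  (a * b) * (a * b) + ε * (b * b)          ≡⟨ solve 3 (λ a b e →
    (a :* b) :* (a :* b) :+ e :* (b :* b) := (a :* a :+ con 1ℚ :* e) :* (b :* b)) refl a b ε ⟩
  (a * a + 1ℚ * ε) * (b * b)               ≤⟨ *-mono-≤-nonNeg (0≤p*p b) (ℚ.≤-trans (0≤p*p r) r²≤u) (begin
    a * a + 1ℚ * ε                           ≤⟨ ℚ.+-monoʳ-≤ (a * a) (*-mono-≤-nonNeg 0≤ε 0≤a 1≤a ℚ.≤-refl) ⟩
    a * a + a * ε                            ≡⟨ ℚ.*-distribˡ-+ a a ε ⟨
    a * (a + ε)                              ≤⟨ *-mono-≤-nonNeg 0≤a+ε 0≤r (ℚ.≤-trans (p≤p+q a 0≤ε) a+ε≤r) a+ε≤r ⟩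
    r * r                                    ≤⟨ r²≤u ⟩
    u                                        ∎) b²≤v ⟩
  u * v                                    ∎
  where
  open ℚ.≤-Reasoning
  0≤a : 0ℚ ≤ a
  0≤a = ℚ.≤-trans 0≤1 1≤a
  0≤a+ε : 0ℚ ≤ a + ε
  0≤a+ε = ℚ.≤-trans 0≤a (p≤p+q a 0≤ε)
  0≤r : 0ℚ ≤ r
  0≤r = ℚ.≤-trans 0≤a+ε a+ε≤r
  1≤b² : 1ℚ ≤ b * b
  1≤b² = *-mono-≤-nonNeg 0≤1 (ℚ.≤-trans 0≤1 1≤b) 1≤b 1≤b

1≤fromℕ : ∀ {n} → 1 ℕ.≤ n → 1ℚ ≤ fromℕ n
1≤fromℕ {suc n} _ = begin
  1ℚ                ≤⟨ p≤p+q 1ℚ (0≤fromℕ n) ⟩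
  1ℚ + fromℕ n      ≡⟨ ℚ.+-comm 1ℚ (fromℕ n) ⟩
  fromℕ n + 1ℚ      ≡⟨ fromℕ-suc n ⟨
  fromℕ (suc n)     ∎
  where open ℚ.≤-Reasoning

-- `a j` is to be the lower bound for the distance from `z` to `j`: `m ∸ j` when `|z|` is too large,
-- `suc j` when the real part is too small. Over `j < m` either choice has product `m!`.
∏ : (ℕ → ℕ) → ℕ → ℕ
∏ a zero    = 1
∏ a (suc k) = a k ℕ.* ∏ a k

∏-suc : ∀ k → ∏ suc k ≡ k !
∏-suc zero    = refl
∏-suc (suc k) = cong (suc k ℕ.*_) (∏-suc k)

∏-∸ : ∀ m k → ∏ (m ∸_) k ≡ m P′ k
∏-∸ m zero    = refl
∏-∸ m (suc k) = cong ((m ∸ k) ℕ.*_) (∏-∸ m k)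

∏-positive : ∀ a k → (∀ j → j ℕ.< k → 1 ℕ.≤ a j) → 1 ℕ.≤ ∏ a k
∏-positive a zero    _ = ℕ.≤-refl
∏-positive a (suc k) h = ℕ.*-mono-≤ (h k ℕ.≤-refl) (∏-positive a k λ j j<k → h j (ℕ.m<n⇒m<1+n j<k))

module _ (z : ℂ) (n : ℕ) {ε : ℚ} (0≤ε : 0ℚ ≤ ε) (a : ℕ → ℕ) (r : ℕ → ℚ) where

  -- Speaks of the n-th rational approximations only. The rational `r j` is a lower bound for the
  -- distance from `z` to `j`, compared through squares, and it clears `a j` by `ε`.
  Dominated : ℕ → Set
  Dominated k = ∀ j → j ℕ.< k →
    1 ℕ.≤ a j × fromℕ (a j) + ε ≤ r j × r j * r j ≤ seq ∣ z +ℂ (-ℂ ℕ→ℂ j) ∣² n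

  -- Mutual induction with the gap below: the empty product equals its bound, so a gap appears only
  -- from the first factor on. In each step the new factor supplies the gap, the earlier ones just
  -- the plain bound.
  ∣falling∣²-lower : ∀ k → Dominated k →
    fromℕ (∏ a k) * fromℕ (∏ a k) ≤ seq ∣ fallingℂ z k ∣² n
  ∣falling∣²-gap : ∀ k → Dominated (suc k) →
    fromℕ (∏ a (suc k)) * fromℕ (∏ a (suc k)) + ε ≤ seq ∣ fallingℂ z (suc k) ∣² n

  ∣falling∣²-lower zero    h = ℚ.≤-refl
  ∣falling∣²-lower (suc k) h = ℚ.≤-trans (p≤p+q _ 0≤ε) (∣falling∣²-gap k h)

  ∣falling∣²-gap k h = begin
    fromℕ (a k ℕ.* ∏ a k) * fromℕ (a k ℕ.* ∏ a k) + ε   ≡⟨ cong (λ p → p * p + ε) (fromℕ-* (a k) (∏ a k)) ⟩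
    (fromℕ (a k) * fromℕ (∏ a k)) * (fromℕ (a k) * fromℕ (∏ a k)) + ε
      ≤⟨ product-gap 0≤ε (1≤fromℕ 1≤ak) (1≤fromℕ (∏-positive a k λ j j<k → proj₁ (h′ j j<k)))
           ak+ε≤rk rk²≤ (∣falling∣²-lower k h′) ⟩
    seq ∣ z +ℂ (-ℂ ℕ→ℂ k) ∣² n * seq ∣ fallingℂ z k ∣² n   ≡⟨ ∣∣²-* (z +ℂ (-ℂ ℕ→ℂ k)) (fallingℂ z k) n ⟨
    seq ∣ fallingℂ z (suc k) ∣² n                      ∎
    where
    open ℚ.≤-Reasoning
    1≤ak = proj₁ (h k ℕ.≤-refl)
    ak+ε≤rk = proj₁ (proj₂ (h k ℕ.≤-refl))
    rk²≤ = proj₂ (proj₂ (h k ℕ.≤-refl))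
    h′ : Dominated k
    h′ j j<k = h j (ℕ.m<n⇒m<1+n j<k)

-- Beyond `N` the squared modulus is within `ε/2` of `(m!)²`, whereas domination would force an
-- excess of `ε`. `N` does not depend on `a` or `r`, so these may be chosen at each index.
falling≈m!⇒¬Dominated : ∀ k z → fallingℂ z (suc k) ≈ℂ ℕ→ℂ (suc k !) → ∀ {ε} (0<ε : 0ℚ < ε) →
  ∃[ N ] (∀ n → N ℕ.≤ n → ∀ a r → ∏ a (suc k) ≡ suc k ! → ¬ Dominated z n (ℚ.<⇒≤ 0<ε) a r (suc k))
falling≈m!⇒¬Dominated k z eq {ε} 0<ε =
  let N , hN = ∣∣²-cong (fallingℂ z (suc k)) (ℕ→ℂ (suc k !)) eq (½ * ε) (½-pos 0<ε)
  in N , λ n N≤n a r ∏≡ dom → ℚ.<-irrefl refl (begin-strict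
    b * b + ½ * ε                        <⟨ ℚ.+-monoʳ-< (b * b) ½ε<ε ⟩
    b * b + ε                            ≡⟨ cong (λ p → fromℕ p * fromℕ p + ε) ∏≡ ⟨
    fromℕ (∏ a (suc k)) * fromℕ (∏ a (suc k)) + ε
                                         ≤⟨ ∣falling∣²-gap z n (ℚ.<⇒≤ 0<ε) a r k dom ⟩
    seq ∣ fallingℂ z (suc k) ∣² n     ≤⟨ ∣p-q∣≤r⇒p≤q+r (hN n N≤n) ⟩
    b * b + 0ℚ * 0ℚ + ½ * ε              ≡⟨ cong (_+ ½ * ε) (ℚ.+-identityʳ (b * b)) ⟩
    b * b + ½ * ε                        ∎)
  where
  open ℚ.≤-Reasoning
  b = fromℕ (suc k !)
  ½ε<ε : ½ * ε < ε
  ½ε<ε = subst₂ _<_ (ℚ.+-identityʳ (½ * ε)) (halves ε) (ℚ.+-monoʳ-< (½ * ε) (½-pos 0<ε))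

-- Moving z away from the origin without changing its direction only increases
-- its distance to j once |z| ≥ j.
norm-translate : ∀ x y s j → 0ℚ ≤ j → j ≤ s → s * s ≤ x * x + y * y →
  (s - j) * (s - j) ≤ (x - j) * (x - j) + (y - 0ℚ) * (y - 0ℚ)
norm-translate x y s j 0≤j j≤s s²≤ with ℚ.≤-total x s
-- Expand `|z - j|² = |z|² - 2jx + j²` and use `s² ≤ |z|²` together with `jx ≤ js`.
... | inj₁ x≤s = begin
  (s - j) * (s - j)                              ≡⟨ solve 2 (λ s j →
    (s :- j) :* (s :- j) := s :* s :+ (j :* j :- (j :* s :+ j :* s))) refl s j ⟩
  s * s + (j * j - (j * s + j * s))              ≤⟨ ℚ.+-mono-≤ s²≤
    (ℚ.+-monoʳ-≤ (j * j) (ℚ.neg-antimono-≤ (ℚ.+-mono-≤ jx≤js jx≤js))) ⟩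
  x * x + y * y + (j * j - (j * x + j * x))      ≡⟨ solve 3 (λ x y j →
    x :* x :+ y :* y :+ (j :* j :- (j :* x :+ j :* x)) :=
    (x :- j) :* (x :- j) :+ (y :- con 0ℚ) :* (y :- con 0ℚ)) refl x y j ⟩
  (x - j) * (x - j) + (y - 0ℚ) * (y - 0ℚ)        ∎
  where
  open ℚ.≤-Reasoning
  jx≤js : j * x ≤ j * s
  jx≤js = ℚ.*-monoˡ-≤-nonNeg j {{nonNegative 0≤j}} x≤s
-- Possible since `s` is merely a lower bound for `|z|`; the horizontal distance `x - j` alone is
-- then enough.
... | inj₂ s≤x = ℚ.≤-trans
  (*-mono-≤-nonNeg 0≤s-j (ℚ.≤-trans 0≤s-j s-j≤x-j) s-j≤x-j s-j≤x-j)
  (p≤p+q _ (0≤p*p (y - 0ℚ)))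
  where
  s-j≤x-j = ℚ.+-monoˡ-≤ (- j) s≤x
  0≤s-j : 0ℚ ≤ s - j
  0≤s-j = subst (_≤ s - j) (ℚ.+-inverseʳ j) (ℚ.+-monoˡ-≤ (- j) j≤s)

-- If the rounded root `s` of `|z|²` exceeded `m + ε` at a late index, the rationals `s - j` would
-- clear `m - j` by `ε` and dominate all factors.
falling≈m!⇒∣z∣≤m : ∀ k z → fallingℂ z (suc k) ≈ℂ ℕ→ℂ (suc k !) → ∣ z ∣ℂ ≤ℝ ℕ→ℝ (suc k)
falling≈m!⇒∣z∣≤m k z eq ε 0<ε =
  let N , hN = falling≈m!⇒¬Dominated k z eq 0<ε
  in N , λ n N≤n → ℚ.≮⇒≥ λ m+ε<s →
    hN n N≤n (m ∸_) (λ j → √≈ n (seq ∣ z ∣² n) - fromℕ j) (trans (∏-∸ m m) (nP′n≡n! m))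
      (dominated n m+ε<s (√≈-lower n (seq ∣ z ∣² n)))
  where
  open ℚ.≤-Reasoning
  m = suc k
  0≤ε = ℚ.<⇒≤ 0<ε
  dominated : ∀ n → let s = √≈ n (seq ∣ z ∣² n) in
    fromℕ m + ε < s → s ≡ 0ℚ ⊎ s * s ≤ seq ∣ z ∣² n →
    Dominated z n 0≤ε (m ∸_) (λ j → s - fromℕ j) m
  -- The default value 0 of the rounded root comes with no bound on its square, but it cannot exceed
  -- `m + ε`.
  dominated n m+ε<s (inj₁ s≡0) = contradiction
    (ℚ.<-≤-trans (subst (fromℕ m + ε <_) s≡0 m+ε<s) (ℚ.≤-trans (0≤fromℕ m) (p≤p+q (fromℕ m) 0≤ε)))
    (ℚ.<-irrefl refl)
  dominated n m+ε<s (inj₂ s²≤) j j<m =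
      ℕ.m<n⇒0<n∸m j<m
    , m-j+ε≤s-j
    , norm-translate (re z n) (im z n) s (fromℕ j) (0≤fromℕ j) j≤s s²≤
    where
    s = √≈ n (seq ∣ z ∣² n)
    m≡ : fromℕ m ≡ fromℕ (m ∸ j) + fromℕ j
    m≡ = trans (cong fromℕ (sym (ℕ.m∸n+n≡m (ℕ.<⇒≤ j<m)))) (fromℕ-+ (m ∸ j) j)
    j≤s : fromℕ j ≤ s
    j≤s = begin
      fromℕ j                        ≤⟨ p≤p+q (fromℕ j) (0≤fromℕ (m ∸ j)) ⟩
      fromℕ j + fromℕ (m ∸ j)        ≡⟨ ℚ.+-comm (fromℕ j) (fromℕ (m ∸ j)) ⟩
      fromℕ (m ∸ j) + fromℕ j        ≡⟨ m≡ ⟨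
      fromℕ m                        ≤⟨ p≤p+q (fromℕ m) 0≤ε ⟩
      fromℕ m + ε                    <⟨ m+ε<s ⟩
      s                              ∎
    m-j+ε≤s-j : fromℕ (m ∸ j) + ε ≤ s - fromℕ j
    m-j+ε≤s-j = begin
      fromℕ (m ∸ j) + ε                          ≡⟨ solve 3 (λ a j e →
        a :+ e := (a :+ j :+ e) :- j) refl (fromℕ (m ∸ j)) (fromℕ j) ε ⟩
      (fromℕ (m ∸ j) + fromℕ j + ε) - fromℕ j    ≡⟨ cong (λ p → (p + ε) - fromℕ j) m≡ ⟨
      (fromℕ m + ε) - fromℕ j                    ≤⟨ ℚ.+-monoˡ-≤ (- fromℕ j) (ℚ.<⇒≤ m+ε<s) ⟩
      s - fromℕ j                                ∎

-- Dropping the imaginary part, `j - x` bounds the distance to `j`, and `x + ε < -1` makes it exceed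
-- `j + 1 + ε`. The constant -1 is the one for which the bounds become `1, 2, ..., m`, with product
-- `m!`.
falling≈m!⇒-1≤Re : ∀ k z → fallingℂ z (suc k) ≈ℂ ℕ→ℂ (suc k !) → -ℝ 1ℝ ≤ℝ Re z
falling≈m!⇒-1≤Re k z eq ε 0<ε =
  let N , hN = falling≈m!⇒¬Dominated k z eq 0<ε
  in N , λ n N≤n → ℚ.≮⇒≥ λ x+ε<-1 →
    hN n N≤n suc (λ j → fromℕ j - re z n) (∏-suc (suc k)) λ j _ →
      s≤s z≤n
    , (begin
      fromℕ (suc j) + ε                            ≡⟨ cong (_+ ε) (fromℕ-suc j) ⟩
      fromℕ j + 1ℚ + ε                             ≡⟨ solve 3 (λ j x e →
        j :+ con 1ℚ :+ e := (j :- x :+ con 1ℚ) :+ (x :+ e)) refl (fromℕ j) (re z n) ε ⟩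
      (fromℕ j - re z n + 1ℚ) + (re z n + ε)       ≤⟨ ℚ.+-monoʳ-≤ (fromℕ j - re z n + 1ℚ) (ℚ.<⇒≤ x+ε<-1) ⟩
      (fromℕ j - re z n + 1ℚ) + (- 1ℚ)             ≡⟨ solve 1 (λ a →
        (a :+ con 1ℚ) :+ (:- con 1ℚ) := a) refl (fromℕ j - re z n) ⟩
      fromℕ j - re z n                             ∎)
    , (begin
      (fromℕ j - re z n) * (fromℕ j - re z n)      ≡⟨ solve 2 (λ j x →
        (j :- x) :* (j :- x) := (x :- j) :* (x :- j)) refl (fromℕ j) (re z n) ⟩
      (re z n - fromℕ j) * (re z n - fromℕ j)      ≤⟨ p≤p+q _ (0≤p*p (im z n - 0ℚ)) ⟩
      (re z n - fromℕ j) * (re z n - fromℕ j) + (im z n - 0ℚ) * (im z n - 0ℚ) ∎)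
  where open ℚ.≤-Reasoning

theorem4p4 : (m : ℕ) → m ≥ 1 →
    (d : Polynomial) → IsDescentPolynomial [ m ] d →
    (z₀ : ℂ) → eval d z₀ ≈ℂ 0ℂ →
    (∣ z₀ ∣ℂ ≤ℝ ℕ→ℝ m) × (-ℝ 1ℝ ≤ℝ Re z₀)
theorem4p4 (suc k) _ d isDP z₀ eval≈0 =
  falling≈m!⇒∣z∣≤m k z₀ falling≈ , falling≈m!⇒-1≤Re k z₀ falling≈
  where
  falling≈ : fallingℂ z₀ (suc k) ≈ℂ ℕ→ℂ (suc k !)
  falling≈ = root⇒falling≈m! (suc k) d isDP z₀ eval≈0
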